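{- For every nonnegative integer $\ell$, every nonnegative integer $n$ and every complex number $x$, $$\sum_{k=0}^n (q^{ -3n};q^3)_k \left[\begin{matrix} x,\ q^{1-\ell}/x\\ q,\ -q^{1-\ell},\ q^{1/2},\ -q^{3/2},\ q^{ -1-3n}\end{matrix}\middle| q\right]_k q^k = \left[\begin{matrix} x,\ -x\\ x^2,\ -1\end{matrix}\middle|q\right]_\ell \sum_{i=0}^{\ell}(-1)^i q^{\ell i}\,\frac{1-x^2q^{2i-1}}{(1-x^2q^{ -1})(1-q^{1/2})}\left[\begin{matrix} q^{ -\ell},\ x^2q^{ -1}\\ q,\ x^2q^{\ell}\end{matrix}\middle|q\right]_i\left\{\frac{1-xq^i}{1+xq^{i-1/2}}\left[\begin{matrix} q^{3+i}x,\ q^{3-i}/x\\ q^2,\ q^4\end{matrix}\middle|q^3\right]_n-\frac{q^{1/2}(1-xq^{i-1})}{1+xq^{i-1/2}}\left[\begin{matrix} q^{2+i}x,\ q^{4-i}/x\\ q^2,\ q^4\end{matrix}\middle|q^3\right]_n\right\}.$$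
   Context: $q$ is a complex number with a fixed square root $q^{1/2}$, and $q^{r/2}$ means $(q^{1/2})^r$. For a complex number $a$, a base $p$ and a nonnegative integer $m$, $(a;p)_m=\prod_{j=0}^{m-1}(1-ap^j)$ with $(a;p)_0=1$. The bracket notation means $\left[\begin{matrix} a_1,\dots,a_r\\ b_1,\dots,b_s\end{matrix}\middle|p\right]_m=\frac{(a_1;p)_m\cdots(a_r;p)_m}{(b_1;p)_m\cdots(b_s;p)_m}$ (used with $p=q$ and $p=q^3$). The identity is understood for values of the parameters for which no denominator vanishes. -}

module Defs where

open import Level using (Level; _⊔_)
open import Data.Nat as ℕ using (ℕ; zero; suc)
open import Data.Integer as ℤ using (ℤ; +_; -[1+_])
open import Data.List using (List; []; _∷_; _++_; [_])
open import Data.Product using (∃)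
open import Relation.Nullary using (¬_)
open import Algebra.Bundles using (CommutativeRing)

-- A field "like ℂ": a commutative ring with multiplicative inverses of
-- nonzero elements, of characteristic zero, and algebraically closed.
-- (ℂ is such a field; any such field satisfies exactly the same
-- first-order sentences as ℂ.)
module RingAux {c ℓ : Level} (R : CommutativeRing c ℓ) where
  open CommutativeRing R
  evalPoly : List Carrier → Carrier → Carrier
  evalPoly [] z = 0#
  evalPoly (a ∷ as) z = a + z * evalPoly as z
  fromℕ : ℕ → Carrier
  fromℕ zero = 0#
  fromℕ (suc n) = 1# + fromℕ n

record ComplexField (c ℓ : Level) : Set (Level.suc (c ⊔ ℓ)) where
  field
    commRing : CommutativeRing c ℓ
  open CommutativeRing commRing public
  open RingAux commRing public
  field
    _⁻¹ : Carrier → Carrier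
    inverse : ∀ z → ¬ (z ≈ 0#) → z * (z ⁻¹) ≈ 1#
    char0 : ∀ n → ¬ (fromℕ (suc n) ≈ 0#)
    algClosed : ∀ (a : Carrier) (as : List Carrier) →
                ∃ λ z → evalPoly ((a ∷ as) ++ [ 1# ]) z ≈ 0#

module Notation {c ℓ : Level} (F : ComplexField c ℓ) where
  open ComplexField F

  _^ₙ_ : Carrier → ℕ → Carrier
  y ^ₙ zero = 1#
  y ^ₙ suc m = (y ^ₙ m) * y

  _^ᶻ_ : Carrier → ℤ → Carrier
  y ^ᶻ (+ m) = y ^ₙ m
  y ^ᶻ (-[1+ m ]) = (y ⁻¹) ^ₙ suc m

  poch : Carrier → Carrier → ℕ → Carrier
  poch a p zero = 1#
  poch a p (suc m) = poch a p m * (1# - a * (p ^ₙ m))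

  prodPoch : List Carrier → Carrier → ℕ → Carrier
  prodPoch [] p m = 1#
  prodPoch (a ∷ as) p m = poch a p m * prodPoch as p m

  bracket : List Carrier → List Carrier → Carrier → ℕ → Carrier
  bracket as bs p m = prodPoch as p m * (prodPoch bs p m) ⁻¹

  sumTo : ℕ → (ℕ → Carrier) → Carrier
  sumTo zero f = f 0
  sumTo (suc n) f = sumTo n f + f (suc n)

  -- From here on s plays the role of q^{1/2}, so q^{r/2} = s ^ᶻ r.
  module Identity (s x : Carrier) (ℓ' n : ℕ) where
    q : Carrier
    q = s ^ᶻ (+ 2)

    h : ℤ → Carrier
    h r = s ^ᶻ r

    L : ℤ
    L = + ℓ'
    N : ℤ
    N = + n

    lhs : Carrier
    lhs = sumTo n λ k →
      poch (h (ℤ.- (+ 6 ℤ.* N))) (h (+ 6)) k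
      * bracket (x ∷ h (+ 2 ℤ.- + 2 ℤ.* L) * x ⁻¹ ∷ [])
                (q ∷ - h (+ 2 ℤ.- + 2 ℤ.* L) ∷ h (+ 1) ∷ - h (+ 3)
                   ∷ h (ℤ.- (+ 2) ℤ.- + 6 ℤ.* N) ∷ [])
                q k
      * h (+ 2 ℤ.* + k)

    summand : ℕ → Carrier
    summand i =
      ((- 1#) ^ₙ i) * h (+ 2 ℤ.* L ℤ.* I)
      * ((1# - x * x * h (+ 4 ℤ.* I ℤ.- + 2))
         * ((1# - x * x * h (ℤ.- (+ 2))) * (1# - h (+ 1))) ⁻¹)
      * bracket (h (ℤ.- (+ 2 ℤ.* L)) ∷ x * x * h (ℤ.- (+ 2)) ∷ [])
                (q ∷ x * x * h (+ 2 ℤ.* L) ∷ [])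
                q i
      * ( (1# - x * h (+ 2 ℤ.* I)) * (1# + x * h (+ 2 ℤ.* I ℤ.- + 1)) ⁻¹
            * bracket (h (+ 6 ℤ.+ + 2 ℤ.* I) * x ∷ h (+ 6 ℤ.- + 2 ℤ.* I) * x ⁻¹ ∷ [])
                      (h (+ 4) ∷ h (+ 8) ∷ []) (h (+ 6)) n
        - h (+ 1) * (1# - x * h (+ 2 ℤ.* I ℤ.- + 2)) * (1# + x * h (+ 2 ℤ.* I ℤ.- + 1)) ⁻¹
            * bracket (h (+ 4 ℤ.+ + 2 ℤ.* I) * x ∷ h (+ 8 ℤ.- + 2 ℤ.* I) * x ⁻¹ ∷ [])
                      (h (+ 4) ∷ h (+ 8) ∷ []) (h (+ 6)) n )
      where
        I : ℤ
        I = + i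

    rhs : Carrier
    rhs = bracket (x ∷ - x ∷ []) (x * x ∷ - 1# ∷ []) q ℓ' * sumTo ℓ' summand

    -- "no denominator vanishes" (a product of q-shifted factorials at the
    -- top index is nonzero iff it is nonzero at every smaller index)
    record Admissible : Set ℓ where
      field
        s≢0 : ¬ (s ≈ 0#)
        x≢0 : ¬ (x ≈ 0#)
        d-lhs : ¬ (prodPoch (q ∷ - h (+ 2 ℤ.- + 2 ℤ.* L) ∷ h (+ 1) ∷ - h (+ 3)
                              ∷ h (ℤ.- (+ 2) ℤ.- + 6 ℤ.* N) ∷ []) q n ≈ 0#)
        d-pre : ¬ (prodPoch (x * x ∷ - 1# ∷ []) q ℓ' ≈ 0#)
        d-frac : ¬ ((1# - x * x * h (ℤ.- (+ 2))) * (1# - h (+ 1)) ≈ 0#)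
        d-br : ¬ (prodPoch (q ∷ x * x * h (+ 2 ℤ.* L) ∷ []) q ℓ' ≈ 0#)
        d-half : ∀ i → i ℕ.≤ ℓ' → ¬ (1# + x * h (+ 2 ℤ.* + i ℤ.- + 1) ≈ 0#)
        d-cube : ¬ (prodPoch (h (+ 4) ∷ h (+ 8) ∷ []) (h (+ 6)) n ≈ 0#)

{-# OPTIONS --safe #-}

-- For ℓ = 0 put y = x: splitting 1 − q^{k+1/2} over 1 − yq^k and q^{k+1} − y turns
-- the left side into two instances of the cubic expansion
--   Σ_k C(n,k) q^{k²+k} (yq;q)_k (q/y;q)_k = (q³y;q³)_n (q³/y;q³)_n,
-- which follows by induction on n, since multiplying the k-th basis element by
-- (1 − q^{3n+3}y)(1 − q^{3n+3}/y) gives a combination of the k-th and the next one.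
-- For general ℓ, (x)_k (q^{1−ℓ}/x)_k / (−q^{1−ℓ})_k is expanded in the products
-- (xq^i)_k (q^{1−i}/x)_k, each of which is the case ℓ = 0 with y = xq^i.
-- The hypotheses allow (−q;q)_k to vanish, so no step divides by it.
module Submission where

open import Defs
open import Algebra.Bundles using (CommutativeRing)
open import Algebra.Solver.Ring.AlmostCommutativeRing
  using (AlmostCommutativeRing; fromCommutativeRing; _-Raw-AlmostCommutative⟶_)
import Algebra.Solver.Ring as RingSolver
import Algebra.Properties.Ring as RingProperties
import Algebra.Properties.Semiring.Mult.TCOptimised as Mult
open import Data.Integer as ℤ using (ℤ; +_; -[1+_]; _⊖_; _◃_)
import Data.Integer.Properties as ℤₚ
open import Data.Integer.Tactic.RingSolver using (solve-∀)
open import Data.List using ([]; _∷_)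
open import Data.Maybe.Base using (Maybe; just; nothing)
open import Data.Nat as ℕ using (ℕ; zero; suc)
import Data.Nat.Properties as ℕₚ
open import Data.Product using (_,_)
import Data.Sign as Sign
open import Level using (Level)
open import Relation.Binary.PropositionalEquality as ≡ using (_≡_)
open import Relation.Nullary using (¬_; yes; no)

-- The factor `1 - q^{k+1/2}` has its origin in the denominators `q, -q, q^{1/2}, -q^{3/2}` of the
-- case ℓ = 0. With `q^{3/2}` in place of `q^{1/2}` their factorials would multiply to
-- `(q²;q)_{2k}`, and the exchange costs `(q^{3/2};q)_k / (q^{1/2};q)_k = (1 - q^{k+1/2}) / (1 -
-- q^{1/2})`. What is left of the summand, apart from the factors containing `x`, is
-- `q^{k²+k} C(n,k) / C(n,0)`. The passage to general ℓ is an induction on ℓ for all `x` at once: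
-- the contiguous relation that lowers ℓ also moves `x` to `xq`, hence `a = x²/q` to `aq²`. The
-- coefficients satisfy the same relation, so no summation theorem is quoted. The theorem then
-- follows by interchanging two finite sums. The main obstacle is vanishing factors: `q` may be a
-- root of unity that kills `(q³;q³)_n` without violating a hypothesis. Hence quotients are replaced
-- by products or recursions, ratios are cross-multiplied, and only quantities that the hypotheses
-- make nonzero are cancelled.

module IntegerCoefficientSolver {c ℓ : Level} (R : CommutativeRing c ℓ) where
  open CommutativeRing R
  open RingProperties ring
  open Mult semiring
  open import Relation.Binary.Reasoning.Setoid setoid

  -- A ring solver with integer coefficients.

  fromℤ : ℤ → Carrier
  fromℤ (+ n) = n × 1#
  fromℤ -[1+ n ] = - (suc n × 1#)

  signed : Sign.Sign → Carrier → Carrier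
  signed Sign.+ a = a
  signed Sign.- a = - a

  cancel-suc : ∀ a b → a - b ≈ (1# + a) - (1# + b)
  cancel-suc a b = begin
    a - b                        ≈⟨ +-identityˡ _ ⟨
    0# + (a - b)                 ≈⟨ +-congʳ (-‿inverseʳ 1#) ⟨
    (1# - 1#) + (a - b)          ≈⟨ +-assoc _ _ _ ⟩
    1# + (- 1# + (a + - b))      ≈⟨ +-congˡ (+-assoc _ _ _) ⟨
    1# + ((- 1# + a) + - b)      ≈⟨ +-congˡ (+-congʳ (+-comm _ _)) ⟩
    1# + ((a + - 1#) + - b)      ≈⟨ +-congˡ (+-assoc _ _ _) ⟩
    1# + (a + (- 1# + - b))      ≈⟨ +-assoc _ _ _ ⟨
    (1# + a) + (- 1# + - b)      ≈⟨ +-congˡ (-‿+-comm 1# b) ⟩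
    (1# + a) - (1# + b)          ∎

  fromℤ-⊖ : ∀ m n → fromℤ (m ⊖ n) ≈ m × 1# - n × 1#
  fromℤ-⊖ zero zero = sym (-‿inverseʳ 0#)
  fromℤ-⊖ zero (suc n) = sym (+-identityˡ _)
  fromℤ-⊖ (suc m) zero = begin
    suc m × 1#           ≈⟨ +-identityʳ _ ⟨
    suc m × 1# + 0#      ≈⟨ +-congˡ -0#≈0# ⟨
    suc m × 1# - 0#      ∎
  fromℤ-⊖ (suc m) (suc n) = begin
    fromℤ (suc m ⊖ suc n)              ≡⟨ ≡.cong fromℤ (ℤₚ.[1+m]⊖[1+n]≡m⊖n m n) ⟩
    fromℤ (m ⊖ n)                      ≈⟨ fromℤ-⊖ m n ⟩
    m × 1# - n × 1#                    ≈⟨ cancel-suc _ _ ⟩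
    (1# + m × 1#) - (1# + n × 1#)      ≈⟨ +-cong (1+× m 1#) (-‿cong (1+× n 1#)) ⟨
    suc m × 1# - suc n × 1#            ∎

  fromℤ-+ : ∀ i j → fromℤ (i ℤ.+ j) ≈ fromℤ i + fromℤ j
  fromℤ-+ (+ m) (+ n) = ×-homo-+ 1# m n
  fromℤ-+ (+ m) -[1+ n ] = fromℤ-⊖ m (suc n)
  fromℤ-+ -[1+ m ] (+ n) = trans (fromℤ-⊖ n (suc m)) (+-comm _ _)
  fromℤ-+ -[1+ m ] -[1+ n ] = begin
    - (suc (suc (m ℕ.+ n)) × 1#)      ≡⟨ ≡.cong (λ k → - (suc k × 1#)) (ℕₚ.+-suc m n) ⟨
    - ((suc m ℕ.+ suc n) × 1#)        ≈⟨ -‿cong (×-homo-+ 1# (suc m) (suc n)) ⟩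
    - (suc m × 1# + suc n × 1#)       ≈⟨ -‿+-comm _ _ ⟨
    - (suc m × 1#) - suc n × 1#       ∎

  fromℤ-◃ : ∀ σ n → fromℤ (σ ◃ n) ≈ signed σ (n × 1#)
  fromℤ-◃ Sign.+ zero = refl
  fromℤ-◃ Sign.+ (suc n) = refl
  fromℤ-◃ Sign.- zero = sym -0#≈0#
  fromℤ-◃ Sign.- (suc n) = refl

  fromℤ-* : ∀ i j → fromℤ (i ℤ.* j) ≈ fromℤ i * fromℤ j
  fromℤ-* (+ m) (+ n) = trans (fromℤ-◃ Sign.+ (m ℕ.* n)) (×1-homo-* m n)
  fromℤ-* (+ m) -[1+ n ] = begin
    fromℤ (Sign.- ◃ (m ℕ.* suc n))     ≈⟨ fromℤ-◃ Sign.- (m ℕ.* suc n) ⟩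
    - ((m ℕ.* suc n) × 1#)             ≈⟨ -‿cong (×1-homo-* m (suc n)) ⟩
    - (m × 1# * suc n × 1#)            ≈⟨ -‿distribʳ-* _ _ ⟩
    m × 1# * - (suc n × 1#)            ∎
  fromℤ-* -[1+ m ] (+ n) = begin
    fromℤ (Sign.- ◃ (suc m ℕ.* n))     ≈⟨ fromℤ-◃ Sign.- (suc m ℕ.* n) ⟩
    - ((suc m ℕ.* n) × 1#)             ≈⟨ -‿cong (×1-homo-* (suc m) n) ⟩
    - (suc m × 1# * n × 1#)            ≈⟨ -‿distribˡ-* _ _ ⟩
    - (suc m × 1#) * n × 1#            ∎
  fromℤ-* -[1+ m ] -[1+ n ] = begin
    (suc m ℕ.* suc n) × 1#             ≈⟨ ×1-homo-* (suc m) (suc n) ⟩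
    suc m × 1# * suc n × 1#            ≈⟨ -‿involutive _ ⟨
    - - (suc m × 1# * suc n × 1#)      ≈⟨ -‿cong (-‿distribˡ-* _ _) ⟩
    - (- (suc m × 1#) * suc n × 1#)    ≈⟨ -‿distribʳ-* _ _ ⟩
    - (suc m × 1#) * - (suc n × 1#)    ∎

  fromℤ-neg : ∀ i → fromℤ (ℤ.- i) ≈ - fromℤ i
  fromℤ-neg (+ zero) = sym -0#≈0#
  fromℤ-neg (+ suc n) = refl
  fromℤ-neg -[1+ n ] = sym (-‿involutive _)

  almostCommutativeRing : AlmostCommutativeRing c ℓ
  almostCommutativeRing = fromCommutativeRing R

  fromℤ-morphism : CommutativeRing.rawRing ℤₚ.+-*-commutativeRing -Raw-AlmostCommutative⟶ almostCommutativeRing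
  fromℤ-morphism = record
    { ⟦_⟧ = fromℤ ; +-homo = fromℤ-+ ; *-homo = fromℤ-* ; -‿homo = fromℤ-neg
    ; 0-homo = refl ; 1-homo = refl }

  -- The carrier has no decidable equality; comparing integer coefficients is enough for the solver
  -- to cancel like terms.
  fromℤ-≟ : ∀ i j → Maybe (fromℤ i ≈ fromℤ j)
  fromℤ-≟ i j with i ℤ.≟ j
  ... | yes i≡j = just (reflexive (≡.cong fromℤ i≡j))
  ... | no _ = nothing

  open RingSolver (CommutativeRing.rawRing ℤₚ.+-*-commutativeRing) almostCommutativeRing
    fromℤ-morphism fromℤ-≟ public

  𝟙 : ∀ {n} → Polynomial n
  𝟙 = con (+ 1)

-- Cancellation, shifted factorials and finite sums.

module FieldLemmas {c ℓ : Level} (F : ComplexField c ℓ) where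
  open ComplexField F hiding (zero)
  open Notation F
  open IntegerCoefficientSolver commRing using (solve; _:=_; _:+_; _:*_; _:-_; :-_; 𝟙)
  open import Relation.Binary.Reasoning.Setoid setoid

  infix 4 _≉0
  _≉0 : Carrier → Set ℓ
  a ≉0 = ¬ (a ≈ 0#)

  ≉0-resp : ∀ {a b} → a ≈ b → a ≉0 → b ≉0
  ≉0-resp a≈b a≉0 b≈0 = a≉0 (trans a≈b b≈0)

  *-≉0ˡ : ∀ {a b} → a * b ≉0 → a ≉0
  *-≉0ˡ ab≉0 a≈0 = ab≉0 (trans (*-congʳ a≈0) (zeroˡ _))

  *-≉0ʳ : ∀ {a b} → a * b ≉0 → b ≉0
  *-≉0ʳ ab≉0 b≈0 = ab≉0 (trans (*-congˡ b≈0) (zeroʳ _))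

  *-cancelʳ-≉0 : ∀ {a b d} → d ≉0 → a * d ≈ b * d → a ≈ b
  *-cancelʳ-≉0 {a} {b} {d} d≉0 ad≈bd = begin
    a                  ≈⟨ *-identityʳ a ⟨
    a * 1#             ≈⟨ *-congˡ (inverse d d≉0) ⟨
    a * (d * d ⁻¹)     ≈⟨ *-assoc _ _ _ ⟨
    a * d * d ⁻¹       ≈⟨ *-congʳ ad≈bd ⟩
    b * d * d ⁻¹       ≈⟨ *-assoc _ _ _ ⟩
    b * (d * d ⁻¹)     ≈⟨ *-congˡ (inverse d d≉0) ⟩
    b * 1#             ≈⟨ *-identityʳ b ⟩
    b                  ∎

  *-≉0 : ∀ {a b} → a ≉0 → b ≉0 → a * b ≉0
  *-≉0 a≉0 b≉0 ab≈0 = a≉0 (*-cancelʳ-≉0 b≉0 (trans ab≈0 (sym (zeroˡ _))))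

  ⁻¹-*-cancel : ∀ {a d} → d ≉0 → a * d ⁻¹ * d ≈ a
  ⁻¹-*-cancel {a} {d} d≉0 = begin
    a * d ⁻¹ * d       ≈⟨ solve 3 (λ a d d′ → a :* d′ :* d := a :* (d :* d′)) refl a d (d ⁻¹) ⟩
    a * (d * d ⁻¹)     ≈⟨ *-congˡ (inverse d d≉0) ⟩
    a * 1#             ≈⟨ *-identityʳ a ⟩
    a                  ∎

  ^ₙ-cong : ∀ {a b} → a ≈ b → ∀ m → a ^ₙ m ≈ b ^ₙ m
  ^ₙ-cong a≈b zero = refl
  ^ₙ-cong a≈b (suc m) = *-cong (^ₙ-cong a≈b m) a≈b

  ^ₙ-distrib-* : ∀ a b m → (a * b) ^ₙ m ≈ a ^ₙ m * b ^ₙ m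
  ^ₙ-distrib-* a b zero = sym (*-identityˡ _)
  ^ₙ-distrib-* a b (suc m) = trans (*-congʳ (^ₙ-distrib-* a b m))
    (solve 4 (λ A B a b → A :* B :* (a :* b) := A :* a :* (B :* b)) refl (a ^ₙ m) (b ^ₙ m) a b)

  poch-cong : ∀ {a b p r} → a ≈ b → p ≈ r → ∀ m → poch a p m ≈ poch b r m
  poch-cong a≈b p≈r zero = refl
  poch-cong a≈b p≈r (suc m) =
    *-cong (poch-cong a≈b p≈r m) (+-congˡ (-‿cong (*-cong a≈b (^ₙ-cong p≈r m))))

  poch-congˡ : ∀ {a b p} → a ≈ b → ∀ m → poch a p m ≈ poch b p m
  poch-congˡ a≈b = poch-cong a≈b refl

  poch-head : ∀ a p m → poch a p (suc m) ≈ (1# - a) * poch (a * p) p m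
  poch-head a p zero = solve 1 (λ a → 𝟙 :* (𝟙 :- a :* 𝟙) := (𝟙 :- a) :* 𝟙) refl a
  poch-head a p (suc m) = begin
    poch a p (suc m) * (1# - a * (p ^ₙ m * p))                  ≈⟨ *-congʳ (poch-head a p m) ⟩
    (1# - a) * poch (a * p) p m * (1# - a * (p ^ₙ m * p))       ≈⟨ solve 4 (λ a p P r →
        (𝟙 :- a) :* P :* (𝟙 :- a :* (r :* p)) := (𝟙 :- a) :* (P :* (𝟙 :- a :* p :* r)))
        refl a p (poch (a * p) p m) (p ^ₙ m) ⟩
    (1# - a) * poch (a * p) p (suc m)                           ∎

  poch-+ : ∀ a p m n → poch a p (m ℕ.+ n) ≈ poch a p m * poch (a * p ^ₙ m) p n
  poch-+ a p zero n = trans (poch-congˡ (sym (*-identityʳ a)) n) (sym (*-identityˡ _))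
  poch-+ a p (suc m) n = begin
    poch a p (suc (m ℕ.+ n))                                      ≈⟨ poch-head a p (m ℕ.+ n) ⟩
    (1# - a) * poch (a * p) p (m ℕ.+ n)                           ≈⟨ *-congˡ (poch-+ (a * p) p m n) ⟩
    (1# - a) * (poch (a * p) p m * poch (a * p * p ^ₙ m) p n)     ≈⟨ *-assoc _ _ _ ⟨
    (1# - a) * poch (a * p) p m * poch (a * p * p ^ₙ m) p n       ≈⟨ *-cong (sym (poch-head a p m))
      (poch-congˡ (solve 3 (λ a p r → a :* p :* r := a :* (r :* p)) refl a p (p ^ₙ m)) n) ⟩
    poch a p (suc m) * poch (a * p ^ₙ suc m) p n                  ∎

  -- The shorter factorial is a factor of the longer one. The hypotheses on shifted factorials speak
  -- only of the top index.
  poch-≉0-≤ : ∀ {a p m n} → m ℕ.≤ n → poch a p n ≉0 → poch a p m ≉0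
  poch-≉0-≤ {a} {p} {m} m≤n nz with ℕₚ.m≤n⇒∃[o]m+o≡n m≤n
  ... | o , ≡.refl = *-≉0ˡ (≉0-resp (poch-+ a p m o) nz)

  sumTo-cong : ∀ n {f g} → (∀ k → k ℕ.≤ n → f k ≈ g k) → sumTo n f ≈ sumTo n g
  sumTo-cong zero f≈g = f≈g 0 ℕ.z≤n
  sumTo-cong (suc n) f≈g =
    +-cong (sumTo-cong n λ k k≤n → f≈g k (ℕₚ.m≤n⇒m≤1+n k≤n)) (f≈g (suc n) ℕₚ.≤-refl)

  sumTo-+ : ∀ n f g → sumTo n (λ k → f k + g k) ≈ sumTo n f + sumTo n g
  sumTo-+ zero f g = refl
  sumTo-+ (suc n) f g = trans (+-congʳ (sumTo-+ n f g))
    (solve 4 (λ A B a b → A :+ B :+ (a :+ b) := A :+ a :+ (B :+ b)) refl _ _ _ _)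

  sumTo-*ˡ : ∀ n a f → a * sumTo n f ≈ sumTo n (λ k → a * f k)
  sumTo-*ˡ zero a f = refl
  sumTo-*ˡ (suc n) a f = trans (distribˡ a _ _) (+-congʳ (sumTo-*ˡ n a f))

  sumTo-*ʳ : ∀ n a f → sumTo n f * a ≈ sumTo n (λ k → f k * a)
  sumTo-*ʳ zero a f = refl
  sumTo-*ʳ (suc n) a f = trans (distribʳ a _ _) (+-congʳ (sumTo-*ʳ n a f))

  sumTo-swap : ∀ m n (f : ℕ → ℕ → Carrier) →
    sumTo m (λ i → sumTo n (f i)) ≈ sumTo n (λ k → sumTo m (λ i → f i k))
  sumTo-swap zero n f = refl
  sumTo-swap (suc m) n f = trans (+-congʳ (sumTo-swap m n f)) (sym (sumTo-+ n _ _))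

  sumTo-head : ∀ n f → sumTo (suc n) f ≈ f 0 + sumTo n (λ k → f (suc k))
  sumTo-head zero f = refl
  sumTo-head (suc n) f = trans (+-congʳ (sumTo-head n f)) (+-assoc _ _ _)

-- Integer powers of `q^{1/2}`.

module Powers {c ℓ : Level} (F : ComplexField c ℓ) (s : ComplexField.Carrier F)
    (s≉0 : ¬ (ComplexField._≈_ F s (ComplexField.0# F))) where
  open ComplexField F hiding (zero)
  open Notation F
  open import Relation.Binary.Reasoning.Setoid setoid

  h : ℤ → Carrier
  h i = s ^ᶻ i

  h-suc : ∀ i → h (i ℤ.+ + 1) ≈ h i * s
  h-suc (+ n) = reflexive (≡.cong (s ^ₙ_) (ℕₚ.+-comm n 1))
  h-suc -[1+ zero ] = sym (trans (*-congʳ (*-identityˡ _)) (trans (*-comm _ _) (inverse s s≉0)))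
  h-suc -[1+ suc n ] = sym (trans (*-assoc _ _ _)
    (trans (*-congˡ (trans (*-comm _ _) (inverse s s≉0))) (*-identityʳ _)))

  h-pred : ∀ i → h (i ℤ.- + 1) ≈ h i * s ⁻¹
  h-pred i = begin
    h (i ℤ.- + 1)                      ≈⟨ *-identityʳ _ ⟨
    h (i ℤ.- + 1) * 1#                 ≈⟨ *-congˡ (inverse s s≉0) ⟨
    h (i ℤ.- + 1) * (s * s ⁻¹)         ≈⟨ *-assoc _ _ _ ⟨
    h (i ℤ.- + 1) * s * s ⁻¹           ≈⟨ *-congʳ (h-suc (i ℤ.- + 1)) ⟨
    h (i ℤ.- + 1 ℤ.+ + 1) * s ⁻¹       ≡⟨ ≡.cong (λ j → h j * s ⁻¹) (i-1+1≡i i) ⟩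
    h i * s ⁻¹                         ∎
    where
    i-1+1≡i : ∀ i → i ℤ.- + 1 ℤ.+ + 1 ≡ i
    i-1+1≡i = solve-∀

  h-+ : ∀ i j → h (i ℤ.+ j) ≈ h i * h j
  h-+ i (+ zero) = trans (reflexive (≡.cong h (ℤₚ.+-identityʳ i))) (sym (*-identityʳ _))
  h-+ i (+ suc n) = begin
    h (i ℤ.+ + suc n)            ≡⟨ ≡.cong h (shift i (+ n)) ⟩
    h (i ℤ.+ + n ℤ.+ + 1)        ≈⟨ h-suc (i ℤ.+ + n) ⟩
    h (i ℤ.+ + n) * s            ≈⟨ *-congʳ (h-+ i (+ n)) ⟩
    h i * h (+ n) * s            ≈⟨ *-assoc _ _ _ ⟩
    h i * h (+ suc n)            ∎
    where
    shift : ∀ i j → i ℤ.+ (+ 1 ℤ.+ j) ≡ i ℤ.+ j ℤ.+ + 1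
    shift = solve-∀
  h-+ i -[1+ zero ] = trans (h-pred i) (*-congˡ (sym (*-identityˡ _)))
  h-+ i -[1+ suc n ] = begin
    h (i ℤ.+ -[1+ suc n ])           ≡⟨ ≡.cong h (≡.trans (≡.cong (λ j → i ℤ.+ j)
                                          (≡.cong (λ m → -[1+ suc m ]) (≡.sym (ℕₚ.+-identityʳ n)))) (≡.sym (ℤₚ.+-assoc i -[1+ n ] (ℤ.- + 1)))) ⟩
    h (i ℤ.+ -[1+ n ] ℤ.- + 1)       ≈⟨ h-pred (i ℤ.+ -[1+ n ]) ⟩
    h (i ℤ.+ -[1+ n ]) * s ⁻¹        ≈⟨ *-congʳ (h-+ i -[1+ n ]) ⟩
    h i * h -[1+ n ] * s ⁻¹          ≈⟨ *-assoc _ _ _ ⟩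
    h i * h -[1+ suc n ]             ∎

  h-split : ∀ {i} j k → i ≡ j ℤ.+ k → h i ≈ h j * h k
  h-split j k ≡.refl = h-+ j k

  h-^ₙ : ∀ i k → h i ^ₙ k ≈ h (i ℤ.* + k)
  h-^ₙ i zero = reflexive (≡.cong h (≡.sym (ℤₚ.*-zeroʳ i)))
  h-^ₙ i (suc k) = trans (*-congʳ (h-^ₙ i k)) (sym (h-split (i ℤ.* + k) i (step i (+ k))))
    where
    step : ∀ i k → i ℤ.* (+ 1 ℤ.+ k) ≡ i ℤ.* k ℤ.+ i
    step = solve-∀

-- The cubic expansion and its coefficients.

module CubicExpansion {c ℓ : Level} (F : ComplexField c ℓ) (s : ComplexField.Carrier F)
    (s≉0 : ¬ (ComplexField._≈_ F s (ComplexField.0# F))) where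
  open ComplexField F hiding (zero)
  open Notation F
  open FieldLemmas F
  open Powers F s s≉0
  open IntegerCoefficientSolver commRing using (solve; _:=_; _:+_; _:*_; _:-_; :-_; 𝟙; Polynomial)
  open import Relation.Binary.Reasoning.Setoid setoid

  q q³ : Carrier
  q = h (+ 2)
  q³ = h (+ 6)

  q³≈q*q*q : q³ ≈ q * q * q
  q³≈q*q*q = solve 1 (λ s → 𝟙 :* s :* s :* s :* s :* s :* s :=
    (𝟙 :* s :* s) :* (𝟙 :* s :* s) :* (𝟙 :* s :* s)) refl s

  -- The exponent is an integer, so the recurrences of `w` need no condition `k ≤ n`.
  w : ℕ → ℕ → Carrier
  w n k = h (+ 6 ℤ.* + n ℤ.- + 6 ℤ.* + k)

  w-suc-suc : ∀ n k → w (suc n) (suc k) ≈ w n k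
  w-suc-suc n k = reflexive (≡.cong h (step (+ n) (+ k)))
    where
    step : ∀ i j → + 6 ℤ.* (+ 1 ℤ.+ i) ℤ.- + 6 ℤ.* (+ 1 ℤ.+ j) ≡ + 6 ℤ.* i ℤ.- + 6 ℤ.* j
    step = solve-∀

  w-sucʳ : ∀ n k → w n k ≈ w n (suc k) * (q * q * q)
  w-sucʳ n k = trans (h-split (+ 6 ℤ.* + n ℤ.- + 6 ℤ.* + suc k) (+ 6) (step (+ n) (+ k))) (*-congˡ q³≈q*q*q)
    where
    step : ∀ i j → + 6 ℤ.* i ℤ.- + 6 ℤ.* j ≡ + 6 ℤ.* i ℤ.- + 6 ℤ.* (+ 1 ℤ.+ j) ℤ.+ + 6
    step = solve-∀

  w-sucˡ : ∀ n k → w (suc n) k ≈ w n k * (q * q * q)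
  w-sucˡ n k = trans (w-sucʳ (suc n) k) (*-congʳ (w-suc-suc n k))

  -- At `w = w n k` and `u = q^k` this is `(1 - q^{3n-k+2})(1 - q^{3n+k+4})`, the value of
  -- `(1 - q^{3n+3}y)(1 - q^{3n+3}/y)` at `y = q^{k+1}`, where the basis element of index `k+1`
  -- vanishes.
  r : Carrier → Carrier → Carrier
  r w u = (1# - w * (u * u) * (q * q)) * (1# - w * (u * u * u * u) * (q * q * q * q))

  r-cong : ∀ {w w′} u → w ≈ w′ → r w u ≈ r w′ u
  r-cong u w≈w′ = *-cong (+-congˡ (-‿cong (*-congʳ (*-congʳ w≈w′))))
    (+-congˡ (-‿cong (*-congʳ (*-congʳ w≈w′))))

  -- At `w = w n k` and `u = q^k` these are the factors of `(q^{2k+2};q)_{3(n-k)}` absent from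
  -- `(q^{2k+4};q)_{3(n-k-1)}`: the first two and the last.
  t : Carrier → Carrier → Carrier
  t w u = (1# - q * q * (u * u)) * (1# - q * q * q * (u * u)) * (1# - w * (u * u) * q)

  t-cong : ∀ {w w′} u → w ≈ w′ → t w u ≈ t w′ u
  t-cong u w≈w′ = *-congˡ (+-congˡ (-‿cong (*-congʳ (*-congʳ w≈w′))))

  -- `r` and `t` in the syntax of the solver, which cannot look inside the originals.
  rᴾ tᴾ : ∀ {m} → Polynomial m → Polynomial m → Polynomial m → Polynomial m
  rᴾ q w u = (𝟙 :- w :* (u :* u) :* (q :* q)) :* (𝟙 :- w :* (u :* u :* u :* u) :* (q :* q :* q :* q))
  tᴾ q w u = (𝟙 :- q :* q :* (u :* u)) :* (𝟙 :- q :* q :* q :* (u :* u)) :* (𝟙 :- w :* (u :* u) :* q)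

  -- C n k = (q^{2k+2};q)_{3(n−k)} / (q³;q³)_{n−k}, built without division so
  -- that it makes sense at roots of unity; w n k is q^{3(n−k)}.
  C : ℕ → ℕ → Carrier
  C zero zero = 1#
  C zero (suc k) = 0#
  C (suc n) zero = C n zero * r (w n zero) 1#
  C (suc n) (suc k) = C n (suc k) * r (w n (suc k)) (q ^ₙ suc k) + w n k * C n k

  C-> : ∀ {n k} → n ℕ.< k → C n k ≈ 0#
  C-> {zero} {suc k} _ = refl
  C-> {suc n} {suc k} (ℕ.s≤s n<k) = begin
    C n (suc k) * r (w n (suc k)) (q ^ₙ suc k) + w n k * C n k
      ≈⟨ +-cong (*-congʳ (C-> (ℕₚ.m<n⇒m<1+n n<k))) (*-congˡ (C-> n<k)) ⟩
    0# * r (w n (suc k)) (q ^ₙ suc k) + w n k * 0#     ≈⟨ +-cong (zeroˡ _) (zeroʳ _) ⟩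
    0# + 0#                                            ≈⟨ +-identityˡ _ ⟩
    0#                                                 ∎

  -- The inductive step of `C-ratio` as a polynomial identity. Here `v` is `w n (k+2)`, and its
  -- neighbours are spelled `vq³` and `vq⁶` so that the solver sees how they are related. The two
  -- hypotheses replace `c₋` by `c₀` and then `c₀` by `c₊` without dividing by `1 - w`, which can be
  -- 0.
  C-ratio-step : ∀ u v c₋ c₀ c₊ →
    (1# - v * (q * q * q) * (q * q * q)) * c₋
      ≈ c₀ * ((1# - u * u) * (1# - q * (u * u)) * (1# - v * (u * u) * (q * q * q * q * q))) →
    (1# - v * (q * q * q)) * c₀ ≈ c₊ * t (v * (q * q * q)) u →
    (1# - v * (q * q * q) * (q * q * q)) *
      (c₀ * r (v * (q * q * q)) u + v * (q * q * q) * (q * q * q) * c₋)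
      ≈ (c₊ * r v (u * q) + v * (q * q * q) * c₀) * t (v * (q * q * q) * (q * q * q)) u
  C-ratio-step u v c₋ c₀ c₊ ih₋ ih₀ = begin
    (1# - v * (q * q * q) * (q * q * q)) *
      (c₀ * r (v * (q * q * q)) u + v * (q * q * q) * (q * q * q) * c₋)
      ≈⟨ solve 4 (λ a b c d → a :* (b :+ c :* d) := a :* b :+ c :* (a :* d)) refl _ _ _ _ ⟩
    (1# - v * (q * q * q) * (q * q * q)) * (c₀ * r (v * (q * q * q)) u)
      + v * (q * q * q) * (q * q * q) * ((1# - v * (q * q * q) * (q * q * q)) * c₋)
      ≈⟨ +-congˡ (*-congˡ ih₋) ⟩
    (1# - v * (q * q * q) * (q * q * q)) * (c₀ * r (v * (q * q * q)) u)
      + v * (q * q * q) * (q * q * q) *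
        (c₀ * ((1# - u * u) * (1# - q * (u * u)) * (1# - v * (u * u) * (q * q * q * q * q))))
      -- The sum is split so that one part contains `(1 - vq³) c₀`, the left side of `ih₀`, while
      -- the other already has the target factor `t`.
      ≈⟨ solve 4 (λ q u v c →
           let v₃ = v :* (q :* q :* q); v₆ = v₃ :* (q :* q :* q)
               U = u :* q in
           (𝟙 :- v₆) :* (c :* rᴾ q v₃ u) :+ v₆ :* (c :* ((𝟙 :- u :* u) :* (𝟙 :- q :* (u :* u)) :* (𝟙 :- v :* (u :* u) :* (q :* q :* q :* q :* q))))
           := (𝟙 :- v₃) :* c :* ((𝟙 :- v :* (U :* U :* U :* U) :* (q :* q :* q :* q)) :* (𝟙 :- v₆ :* (u :* u) :* q))
              :+ v₃ :* c :* tᴾ q v₆ u)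
           refl q u v c₀ ⟩
    (1# - v * (q * q * q)) * c₀ * ((1# - v * (u * q * (u * q) * (u * q) * (u * q)) * (q * q * q * q))
        * (1# - v * (q * q * q) * (q * q * q) * (u * u) * q))
      + v * (q * q * q) * c₀ * t (v * (q * q * q) * (q * q * q)) u
      ≈⟨ +-congʳ (*-congʳ ih₀) ⟩
    c₊ * t (v * (q * q * q)) u * ((1# - v * (u * q * (u * q) * (u * q) * (u * q)) * (q * q * q * q))
        * (1# - v * (q * q * q) * (q * q * q) * (u * u) * q))
      + v * (q * q * q) * c₀ * t (v * (q * q * q) * (q * q * q)) u
      ≈⟨ solve 5 (λ q u v c₊ c₀ →
           let v₃ = v :* (q :* q :* q); v₆ = v₃ :* (q :* q :* q)
               U = u :* q in
           c₊ :* tᴾ q v₃ u :* ((𝟙 :- v :* (U :* U :* U :* U) :* (q :* q :* q :* q)) :* (𝟙 :- v₆ :* (u :* u) :* q))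
              :+ v₃ :* c₀ :* tᴾ q v₆ u
           := (c₊ :* rᴾ q v U :+ v₃ :* c₀) :* tᴾ q v₆ u)
           refl q u v c₊ c₀ ⟩
    (c₊ * r v (u * q) + v * (q * q * q) * c₀) * t (v * (q * q * q) * (q * q * q)) u  ∎

  C-ratio-step′ : ∀ u v w₀ w₁ c₋ c₀ c₊ → w₀ ≈ v * (q * q * q) → w₁ ≈ w₀ * (q * q * q) →
    (1# - w₁) * c₋
      ≈ c₀ * ((1# - u * u) * (1# - q * (u * u)) * (1# - v * (u * u) * (q * q * q * q * q))) →
    (1# - w₀) * c₀ ≈ c₊ * t w₀ u →
    (1# - w₁) * (c₀ * r w₀ u + w₁ * c₋) ≈ (c₊ * r v (u * q) + w₀ * c₀) * t w₁ u
  C-ratio-step′ u v w₀ w₁ c₋ c₀ c₊ w₀≈ w₁≈ ih₋ ih₀ = begin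
    (1# - w₁) * (c₀ * r w₀ u + w₁ * c₋)
      ≈⟨ *-cong (+-congˡ (-‿cong w₁≈′)) (+-cong (*-congˡ (r-cong u w₀≈)) (*-congʳ w₁≈′)) ⟩
    (1# - v * (q * q * q) * (q * q * q)) *
      (c₀ * r (v * (q * q * q)) u + v * (q * q * q) * (q * q * q) * c₋)
      ≈⟨ C-ratio-step u v c₋ c₀ c₊ (trans (*-congʳ (+-congˡ (-‿cong (sym w₁≈′)))) ih₋)
           (trans (*-congʳ (+-congˡ (-‿cong (sym w₀≈)))) (trans ih₀ (*-congˡ (t-cong u w₀≈)))) ⟩
    (c₊ * r v (u * q) + v * (q * q * q) * c₀) * t (v * (q * q * q) * (q * q * q)) u
      ≈⟨ *-cong (+-congˡ (*-congʳ w₀≈)) (t-cong u w₁≈′) ⟨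
    (c₊ * r v (u * q) + w₀ * c₀) * t w₁ u  ∎
    where
    w₁≈′ : w₁ ≈ v * (q * q * q) * (q * q * q)
    w₁≈′ = trans w₁≈ (*-congʳ w₀≈)

  -- The closed form of `C` predicts this ratio, but it can divide by zero; the proof is by
  -- induction on `n` from the recursion. At `k = n` both sides are 0.
  C-ratio : ∀ n k → (1# - w n k) * C n k ≈ C n (suc k) * t (w n k) (q ^ₙ k)
  C-ratio zero zero = trans (*-congʳ (-‿inverseʳ 1#)) (trans (zeroˡ _) (sym (zeroˡ _)))
  C-ratio zero (suc k) = trans (zeroʳ _) (sym (zeroˡ _))
  C-ratio (suc n) zero = begin
    (1# - w (suc n) 0) * (C n 0 * r (w n 0) 1#)
      ≈⟨ *-congˡ (trans (sym (+-identityʳ _)) (+-congˡ (sym (zeroʳ _)))) ⟩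
    (1# - w (suc n) 0) * (C n 0 * r (w n 0) 1# + w (suc n) 0 * 0#)
      -- There is no coefficient of index -1; `0#` takes its place. The hypothesis about it holds
      -- because its factor `1 - u*u` is 0 at `u = 1`.
      ≈⟨ C-ratio-step′ 1# (w n 1) (w n 0) (w (suc n) 0) 0# (C n 0) (C n 1) (w-sucʳ n 0) (w-sucˡ n 0)
           (trans (zeroʳ _) (sym (trans (*-congˡ (trans (*-congʳ (trans (*-congʳ
             (trans (+-congˡ (-‿cong (*-identityˡ 1#))) (-‿inverseʳ 1#))) (zeroˡ _))) (zeroˡ _))) (zeroʳ _))))
           (C-ratio n 0) ⟩
    (C n 1 * r (w n 1) (q ^ₙ 1) + w n 0 * C n 0) * t (w (suc n) 0) 1#  ∎
  C-ratio (suc n) (suc k) = begin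
    (1# - w (suc n) (suc k)) * (C n (suc k) * r (w n (suc k)) u + w n k * C n k)
      ≈⟨ *-congˡ (+-congˡ (*-congʳ (sym (w-suc-suc n k)))) ⟩
    (1# - w (suc n) (suc k)) * (C n (suc k) * r (w n (suc k)) u + w (suc n) (suc k) * C n k)
      ≈⟨ C-ratio-step′ u v (w n (suc k)) (w (suc n) (suc k)) (C n k) (C n (suc k)) (C n (suc (suc k)))
           (w-sucʳ n (suc k)) (w-sucˡ n (suc k)) ih₋ (C-ratio n (suc k)) ⟩
    (C n (suc (suc k)) * r v (u * q) + w n (suc k) * C n (suc k)) * t (w (suc n) (suc k)) u  ∎
    where
    u = q ^ₙ suc k
    v = w n (suc (suc k))
    ih₋ : (1# - w (suc n) (suc k)) * C n k
      ≈ C n (suc k) * ((1# - u * u) * (1# - q * (u * u)) * (1# - v * (u * u) * (q * q * q * q * q)))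
    ih₋ = begin
      (1# - w (suc n) (suc k)) * C n k      ≈⟨ *-congʳ (+-congˡ (-‿cong (w-suc-suc n k))) ⟩
      (1# - w n k) * C n k                  ≈⟨ C-ratio n k ⟩
      C n (suc k) * t (w n k) (q ^ₙ k)
        ≈⟨ *-congˡ (t-cong _ (trans (w-sucʳ n k) (*-congʳ (w-sucʳ n (suc k))))) ⟩
      C n (suc k) * t (v * (q * q * q) * (q * q * q)) (q ^ₙ k)
        ≈⟨ solve 4 (λ c q v u → c :* tᴾ q (v :* (q :* q :* q) :* (q :* q :* q)) u
             := c :* ((𝟙 :- (u :* q) :* (u :* q)) :* (𝟙 :- q :* ((u :* q) :* (u :* q)))
                :* (𝟙 :- v :* ((u :* q) :* (u :* q)) :* (q :* q :* q :* q :* q))))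
             refl (C n (suc k)) q v (q ^ₙ k) ⟩
      C n (suc k) * ((1# - u * u) * (1# - q * (u * u)) * (1# - v * (u * u) * (q * q * q * q * q)))  ∎

  q^k²+k : ℕ → Carrier
  q^k²+k zero = 1#
  q^k²+k (suc k) = q^k²+k k * (q ^ₙ k * q ^ₙ k * (q * q))

  expansionBasis : Carrier → Carrier → ℕ → Carrier
  expansionBasis y y⁻ k = q^k²+k k * (poch (y * q) q k * poch (y⁻ * q) q k)

  q³^ₙ≈w*u³ : ∀ n k → q³ ^ₙ n ≈ w n k * (q ^ₙ k * q ^ₙ k * q ^ₙ k)
  q³^ₙ≈w*u³ n k = begin
    q³ ^ₙ n                              ≈⟨ h-^ₙ (+ 6) n ⟩
    h (+ 6 ℤ.* + n)                      ≈⟨ h-split (+ 6 ℤ.* + n ℤ.- + 6 ℤ.* + k) _ (step (+ n) (+ k)) ⟩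
    w n k * h (+ 2 ℤ.* + k ℤ.+ + 2 ℤ.* + k ℤ.+ + 2 ℤ.* + k)
      ≈⟨ *-congˡ (trans (h-+ (+ 2 ℤ.* + k ℤ.+ + 2 ℤ.* + k) _) (*-congʳ (h-+ (+ 2 ℤ.* + k) _))) ⟩
    w n k * (h (+ 2 ℤ.* + k) * h (+ 2 ℤ.* + k) * h (+ 2 ℤ.* + k))
      ≈⟨ *-congˡ (*-cong (*-cong (h-^ₙ (+ 2) k) (h-^ₙ (+ 2) k)) (h-^ₙ (+ 2) k)) ⟨
    w n k * (q ^ₙ k * q ^ₙ k * q ^ₙ k)   ∎
    where
    step : ∀ i j → + 6 ℤ.* i ≡ + 6 ℤ.* i ℤ.- + 6 ℤ.* j ℤ.+ (+ 2 ℤ.* j ℤ.+ + 2 ℤ.* j ℤ.+ + 2 ℤ.* j)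
    step = solve-∀

  -- Such a product depends on `y` only through `y + y⁻`, and linearly. The products for two values
  -- of `a` are therefore linearly related, which is why multiplying a basis element produces only
  -- two terms.
  reciprocal-pair : ∀ {y y⁻} → y * y⁻ ≈ 1# → ∀ a →
    (1# - a * y) * (1# - a * y⁻) ≈ 1# + a * a - a * (y + y⁻)
  reciprocal-pair {y} {y⁻} yy⁻≈1 a = begin
    (1# - a * y) * (1# - a * y⁻)
      ≈⟨ solve 3 (λ a y y⁻ → (𝟙 :- a :* y) :* (𝟙 :- a :* y⁻) := 𝟙 :+ a :* a :* (y :* y⁻) :- a :* (y :+ y⁻)) refl a y y⁻ ⟩
    1# + a * a * (y * y⁻) - a * (y + y⁻)    ≈⟨ +-congʳ (+-congˡ (trans (*-congˡ yy⁻≈1) (*-identityʳ _))) ⟩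
    1# + a * a - a * (y + y⁻)               ∎

  -- Put `z = q^{3n+3}` and `a = q^{k+1}`. The coefficients of `y + y⁻` match because
  -- `w q^{2k+2} a = z`; the constant that remains factors as `r`.
  expansionBasis-step : ∀ {y y⁻} → y * y⁻ ≈ 1# → ∀ n k →
    expansionBasis y y⁻ k * ((1# - y * q³ * q³ ^ₙ n) * (1# - y⁻ * q³ * q³ ^ₙ n))
      ≈ r (w n k) (q ^ₙ k) * expansionBasis y y⁻ k + w n k * expansionBasis y y⁻ (suc k)
  expansionBasis-step {y} {y⁻} yy⁻≈1 n k = begin
    e * ((1# - y * q³ * q³ ^ₙ n) * (1# - y⁻ * q³ * q³ ^ₙ n))
      ≈⟨ *-congˡ (*-cong (+-congˡ (-‿cong (z≈ y))) (+-congˡ (-‿cong (z≈ y⁻)))) ⟩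
    e * ((1# - z * y) * (1# - z * y⁻))                ≈⟨ *-congˡ (reciprocal-pair yy⁻≈1 z) ⟩
    e * (1# + z * z - z * (y + y⁻))
      ≈⟨ solve 6 (λ e q w u y y⁻ →
           let z = q :* q :* q :* (w :* (u :* u :* u)); a = q :* u in
           e :* (𝟙 :+ z :* z :- z :* (y :+ y⁻))
           := rᴾ q w u :* e :+ w :* (e :* (u :* u :* (q :* q)) :* (𝟙 :+ a :* a :- a :* (y :+ y⁻))))
           refl e q (w n k) u y y⁻ ⟩
    r (w n k) u * e + w n k * (e * (u * u * (q * q)) * (1# + q * u * (q * u) - q * u * (y + y⁻)))
      ≈⟨ +-congˡ (*-congˡ (*-congˡ (reciprocal-pair yy⁻≈1 (q * u)))) ⟨
    r (w n k) u * e + w n k * (e * (u * u * (q * q)) * ((1# - q * u * y) * (1# - q * u * y⁻)))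
      ≈⟨ +-congˡ (*-congˡ (solve 7 (λ E P P⁻ q u y y⁻ →
           (E :* (P :* P⁻)) :* (u :* u :* (q :* q)) :* ((𝟙 :- q :* u :* y) :* (𝟙 :- q :* u :* y⁻))
           := E :* (u :* u :* (q :* q)) :* (P :* (𝟙 :- y :* q :* u) :* (P⁻ :* (𝟙 :- y⁻ :* q :* u))))
           refl (q^k²+k k) (poch (y * q) q k) (poch (y⁻ * q) q k) q u y y⁻)) ⟩
    r (w n k) u * e + w n k * expansionBasis y y⁻ (suc k)  ∎
    where
    e = expansionBasis y y⁻ k
    u = q ^ₙ k
    z = q * q * q * (w n k * (u * u * u))
    z≈ : ∀ y → y * q³ * q³ ^ₙ n ≈ z * y
    z≈ y = trans (*-cong (*-congˡ q³≈q*q*q) (q³^ₙ≈w*u³ n k))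
      (solve 3 (λ y a b → y :* a :* b := a :* b :* y) refl y _ _)

  cubic-expansion : ∀ {y y⁻} → y * y⁻ ≈ 1# → ∀ n →
    sumTo n (λ k → C n k * expansionBasis y y⁻ k) ≈ poch (y * q³) q³ n * poch (y⁻ * q³) q³ n
  cubic-expansion yy⁻≈1 zero = trans (*-identityˡ _) (*-identityˡ _)
  cubic-expansion {y} {y⁻} yy⁻≈1 (suc n) = begin
    sumTo (suc n) (λ k → C (suc n) k * e k)
      ≈⟨ sumTo-head n _ ⟩
    C n 0 * r (w n 0) 1# * e 0 + sumTo n (λ k → (stay (suc k) + w n k * C n k) * e (suc k))
      ≈⟨ +-congˡ (trans (sumTo-cong n λ k _ → distribʳ (e (suc k)) _ _) (sumTo-+ n _ _)) ⟩
    stay 0 * e 0 + (sumTo n (λ k → stay (suc k) * e (suc k)) + sumTo n (λ k → w n k * C n k * e (suc k)))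
      ≈⟨ +-assoc _ _ _ ⟨
    stay 0 * e 0 + sumTo n (λ k → stay (suc k) * e (suc k)) + sumTo n (λ k → w n k * C n k * e (suc k))
      ≈⟨ +-congʳ (sumTo-head n (λ k → stay k * e k)) ⟨
    sumTo n (λ k → stay k * e k) + stay (suc n) * e (suc n) + sumTo n (λ k → w n k * C n k * e (suc k))
      -- `C n (suc n)` is 0, so the sum of the `stay` terms ends at `n` and can be merged with the
      -- other one.
      ≈⟨ +-congʳ (trans (+-congˡ (trans (*-congʳ (trans (*-congʳ (C-> (ℕₚ.n<1+n n))) (zeroˡ _))) (zeroˡ _))) (+-identityʳ _)) ⟩
    sumTo n (λ k → stay k * e k) + sumTo n (λ k → w n k * C n k * e (suc k))
      ≈⟨ sumTo-+ n _ _ ⟨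
    sumTo n (λ k → stay k * e k + w n k * C n k * e (suc k))
      ≈⟨ sumTo-cong n (λ k _ → trans
           (solve 5 (λ c r e w e′ → c :* r :* e :+ w :* c :* e′ := c :* (r :* e :+ w :* e′)) refl (C n k) _ (e k) (w n k) _)
           (trans (*-congˡ (sym (expansionBasis-step yy⁻≈1 n k))) (sym (*-assoc _ _ _)))) ⟩
    sumTo n (λ k → C n k * e k * ((1# - y * q³ * q³ ^ₙ n) * (1# - y⁻ * q³ * q³ ^ₙ n)))
      ≈⟨ sumTo-*ʳ n _ _ ⟨
    sumTo n (λ k → C n k * e k) * ((1# - y * q³ * q³ ^ₙ n) * (1# - y⁻ * q³ * q³ ^ₙ n))
      ≈⟨ *-congʳ (cubic-expansion yy⁻≈1 n) ⟩
    poch (y * q³) q³ n * poch (y⁻ * q³) q³ n * ((1# - y * q³ * q³ ^ₙ n) * (1# - y⁻ * q³ * q³ ^ₙ n))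
      ≈⟨ solve 4 (λ a b c d → a :* b :* (c :* d) := a :* c :* (b :* d)) refl _ _ _ _ ⟩
    poch (y * q³) q³ (suc n) * poch (y⁻ * q³) q³ (suc n)  ∎
    where
    e = expansionBasis y y⁻
    stay : ℕ → Carrier
    stay k = C n k * r (w n k) (q ^ₙ k)

  -- The left summand at ℓ = 0 in terms of `C`.

  pochs₃ : ℕ → Carrier
  pochs₃ n = poch (h (+ 4)) q³ n * poch (h (+ 8)) q³ n

  -- In `(q²;q)_{3n} / (q³;q³)_n` the exponents divisible by 3 cancel. The residues 2 and 1 remain
  -- and form the denominator of the brackets in base `q³`.
  C-zeroʳ : ∀ n → C n 0 ≈ pochs₃ n
  C-zeroʳ zero = sym (*-identityˡ _)
  C-zeroʳ (suc n) = begin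
    C n 0 * r (w n 0) 1#
      ≈⟨ *-cong (C-zeroʳ n) (solve 2 (λ q w → rᴾ q w 𝟙 :=
           (𝟙 :- q :* q :* (w :* (𝟙 :* 𝟙 :* 𝟙))) :* (𝟙 :- q :* q :* q :* q :* (w :* (𝟙 :* 𝟙 :* 𝟙)))) refl q (w n 0)) ⟩
    pochs₃ n * ((1# - q * q * (w n 0 * (1# * 1# * 1#))) * (1# - q * q * q * q * (w n 0 * (1# * 1# * 1#))))
      ≈⟨ *-congˡ (*-cong (+-congˡ (-‿cong (*-cong h4≈ (q³^ₙ≈w*u³ n 0)))) (+-congˡ (-‿cong (*-cong h8≈ (q³^ₙ≈w*u³ n 0))))) ⟨
    pochs₃ n * ((1# - h (+ 4) * q³ ^ₙ n) * (1# - h (+ 8) * q³ ^ₙ n))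
      ≈⟨ solve 4 (λ a b c d → a :* b :* (c :* d) := a :* c :* (b :* d)) refl _ _ _ _ ⟩
    pochs₃ (suc n)  ∎
    where
    h4≈ : h (+ 4) ≈ q * q
    h4≈ = h-+ (+ 2) (+ 2)
    h8≈ : h (+ 8) ≈ q * q * q * q
    h8≈ = trans (h-+ (+ 6) (+ 2)) (*-congʳ q³≈q*q*q)

  -- `C-ratio` multiplied by `-ωq`, where `ω = q^(3k-3n)` is the inverse of `w n k`. This reverses
  -- the two factors containing `w` into the steps of `(q^(-3n);q³)_k` and `(q^(-1-3n);q)_k`, and
  -- leaves `q^{2k+2}`, the step of `q^k²+k`.
  C-ratio′ : ∀ n k → (1# - h (ℤ.- (+ 6 ℤ.* + n)) * q³ ^ₙ k) * q * C n k
    ≈ C n (suc k) * ((1# - q * q * (q ^ₙ k * q ^ₙ k)) * (1# - q * q * q * (q ^ₙ k * q ^ₙ k)))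
      * (q ^ₙ k * q ^ₙ k * (q * q)) * (1# - h (ℤ.- (+ 2) ℤ.- + 6 ℤ.* + n) * q ^ₙ k)
  C-ratio′ n k = begin
    (1# - ω) * q * C n k
      ≈⟨ *-congʳ (*-congʳ (+-cong (sym ωw≈1) (-‿cong (sym (*-identityʳ ω))))) ⟩
    (ω * w n k - ω * 1#) * q * C n k
      ≈⟨ solve 4 (λ o w q c → (o :* w :- o :* 𝟙) :* q :* c := (:- (o :* q)) :* ((𝟙 :- w) :* c)) refl ω (w n k) q (C n k) ⟩
    - (ω * q) * ((1# - w n k) * C n k)
      ≈⟨ *-congˡ (C-ratio n k) ⟩
    - (ω * q) * (C n (suc k) * t (w n k) u)
      ≈⟨ solve 6 (λ o q c a w u → (:- (o :* q)) :* (c :* (a :* (𝟙 :- w :* (u :* u) :* q)))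
           := c :* a :* (o :* w :* (u :* u :* (q :* q)) :- o :* q)) refl ω q (C n (suc k)) _ (w n k) u ⟩
    C n (suc k) * T * (ω * w n k * (u * u * (q * q)) - ω * q)
      ≈⟨ *-congˡ (+-cong (*-congʳ ωw≈1) (-‿cong (*-congʳ ω≈))) ⟩
    C n (suc k) * T * (1# * (u * u * (q * q)) - θ * u * (u * u * q) * q)
      ≈⟨ solve 4 (λ c u q θ → c :* (𝟙 :* (u :* u :* (q :* q)) :- θ :* u :* (u :* u :* q) :* q)
           := c :* (u :* u :* (q :* q)) :* (𝟙 :- θ :* u)) refl _ u q θ ⟩
    C n (suc k) * T * (u * u * (q * q)) * (1# - θ * u)  ∎
    where
    u = q ^ₙ k
    ω = h (ℤ.- (+ 6 ℤ.* + n)) * q³ ^ₙ k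
    θ = h (ℤ.- (+ 2) ℤ.- + 6 ℤ.* + n)
    T = (1# - q * q * (u * u)) * (1# - q * q * q * (u * u))
    u≈ : u ≈ h (+ 2 ℤ.* + k)
    u≈ = h-^ₙ (+ 2) k
    ωw≈1 : ω * w n k ≈ 1#
    ωw≈1 = trans (*-congʳ (*-congˡ (h-^ₙ (+ 6) k))) (sym (trans
      (h-split (ℤ.- (+ 6 ℤ.* + n) ℤ.+ + 6 ℤ.* + k) (+ 6 ℤ.* + n ℤ.- + 6 ℤ.* + k) (step (+ n) (+ k))) (*-congʳ (h-+ (ℤ.- (+ 6 ℤ.* + n)) _))))
      where
      step : ∀ i j → + 0 ≡ ℤ.- (+ 6 ℤ.* i) ℤ.+ + 6 ℤ.* j ℤ.+ (+ 6 ℤ.* i ℤ.- + 6 ℤ.* j)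
      step = solve-∀
    ω≈ : ω ≈ θ * u * (u * u * q)
    ω≈ = begin
      ω                                                             ≈⟨ *-congˡ (h-^ₙ (+ 6) k) ⟩
      h (ℤ.- (+ 6 ℤ.* + n)) * h (+ 6 ℤ.* + k)                       ≈⟨ h-+ (ℤ.- (+ 6 ℤ.* + n)) _ ⟨
      h (ℤ.- (+ 6 ℤ.* + n) ℤ.+ + 6 ℤ.* + k)
        ≈⟨ h-split (ℤ.- (+ 2) ℤ.- + 6 ℤ.* + n ℤ.+ + 2 ℤ.* + k) (+ 2 ℤ.* + k ℤ.+ + 2 ℤ.* + k ℤ.+ + 2) (step (+ n) (+ k)) ⟩
      h (ℤ.- (+ 2) ℤ.- + 6 ℤ.* + n ℤ.+ + 2 ℤ.* + k) * h (+ 2 ℤ.* + k ℤ.+ + 2 ℤ.* + k ℤ.+ + 2)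
        ≈⟨ *-cong (h-+ (ℤ.- (+ 2) ℤ.- + 6 ℤ.* + n) _) (trans (h-+ (+ 2 ℤ.* + k ℤ.+ + 2 ℤ.* + k) (+ 2)) (*-congʳ (h-+ (+ 2 ℤ.* + k) _))) ⟩
      θ * h (+ 2 ℤ.* + k) * (h (+ 2 ℤ.* + k) * h (+ 2 ℤ.* + k) * q)
        ≈⟨ *-cong (*-congˡ u≈) (*-congʳ (*-cong u≈ u≈)) ⟨
      θ * u * (u * u * q)  ∎
      where
      step : ∀ i j → ℤ.- (+ 6 ℤ.* i) ℤ.+ + 6 ℤ.* j
        ≡ ℤ.- (+ 2) ℤ.- + 6 ℤ.* i ℤ.+ + 2 ℤ.* j ℤ.+ (+ 2 ℤ.* j ℤ.+ + 2 ℤ.* j ℤ.+ + 2)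
      step = solve-∀

  pochs₄ : ℕ → Carrier
  pochs₄ k = poch q q k * poch (- q) q k * poch (h (+ 1)) q k * poch (- h (+ 3)) q k

  C-hypergeometric : ∀ n k →
    poch (h (ℤ.- (+ 6 ℤ.* + n))) q³ k * (pochs₃ n * (1# - h (+ 1))) * q ^ₙ k
      ≈ C n k * q^k²+k k * (1# - h (+ 1) * q ^ₙ k) * (pochs₄ k * poch (h (ℤ.- (+ 2) ℤ.- + 6 ℤ.* + n)) q k)
  C-hypergeometric n zero = trans (*-congʳ (*-congˡ (*-congʳ (sym (C-zeroʳ n)))))
    (solve 2 (λ c s → 𝟙 :* (c :* (𝟙 :- s)) :* 𝟙 := c :* 𝟙 :* (𝟙 :- s :* 𝟙) :* (𝟙 :* 𝟙 :* 𝟙 :* 𝟙 :* 𝟙)) refl (C n 0) (h (+ 1)))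
  C-hypergeometric n (suc k) = begin
    P * (1# - ω) * D * (u * q)
      ≈⟨ solve 5 (λ P o D u q → P :* o :* D :* (u :* q) := P :* D :* u :* (o :* q)) refl P (1# - ω) D u q ⟩
    P * D * u * ((1# - ω) * q)
      ≈⟨ *-congʳ (C-hypergeometric n k) ⟩
    C n k * E * (1# - h (+ 1) * u) * (pochs₄ k * G) * ((1# - ω) * q)
      ≈⟨ solve 6 (λ C E a p G o → C :* E :* a :* (p :* G) :* o := E :* a :* p :* G :* (o :* C)) refl (C n k) E _ (pochs₄ k) G _ ⟩
    E * (1# - h (+ 1) * u) * pochs₄ k * G * ((1# - ω) * q * C n k)
      ≈⟨ *-congˡ (C-ratio′ n k) ⟩
    E * (1# - h (+ 1) * u) * pochs₄ k * G * (C n (suc k) * T * U * (1# - θ * u))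
      ≈⟨ solve 8 (λ E a p G C T U b → E :* a :* p :* G :* (C :* T :* U :* b) := C :* (E :* U) :* p :* (T :* a) :* (G :* b))
           refl E _ (pochs₄ k) G (C n (suc k)) T U _ ⟩
    C n (suc k) * (E * U) * pochs₄ k * (T * (1# - h (+ 1) * u)) * (G * (1# - θ * u))
      -- Each of `1 - q^{2k+2}` and `1 - q^{2k+3}` is a difference of squares in powers of `s`. The
      -- factor `1 - q^{k+3/2}` becomes the new half-integral factor, and the old `1 - q^{k+1/2}`
      -- extends `(q^{1/2};q)_k`.
      ≈⟨ *-congʳ (*-congˡ (solve 2 (λ s u → let h₁ = 𝟙 :* s; q = 𝟙 :* s :* s in
           (𝟙 :- q :* q :* (u :* u)) :* (𝟙 :- q :* q :* q :* (u :* u)) :* (𝟙 :- h₁ :* u)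
           := (𝟙 :- h₁ :* (u :* q)) :* ((𝟙 :- q :* u) :* (𝟙 :- (:- q) :* u) :* (𝟙 :- h₁ :* u) :* (𝟙 :- (:- (q :* s)) :* u)))
           refl s u)) ⟩
    C n (suc k) * (E * U) * pochs₄ k * ((1# - h (+ 1) * (u * q)) *
      ((1# - q * u) * (1# - (- q) * u) * (1# - h (+ 1) * u) * (1# - (- h (+ 3)) * u))) * (G * (1# - θ * u))
      ≈⟨ solve 11 (λ C a b c d f a′ b′ c′ d′ g → C :* (a :* b :* c :* d) :* (f :* (a′ :* b′ :* c′ :* d′)) :* g
           := C :* f :* (a :* a′ :* (b :* b′) :* (c :* c′) :* (d :* d′) :* g))
           refl _ (poch q q k) (poch (- q) q k) (poch (h (+ 1)) q k) (poch (- h (+ 3)) q k) _ _ _ _ _ _ ⟩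
    C n (suc k) * (E * U) * (1# - h (+ 1) * (u * q)) * (pochs₄ (suc k) * (G * (1# - θ * u)))  ∎
    where
    u = q ^ₙ k
    P = poch (h (ℤ.- (+ 6 ℤ.* + n))) q³ k
    ω = h (ℤ.- (+ 6 ℤ.* + n)) * q³ ^ₙ k
    θ = h (ℤ.- (+ 2) ℤ.- + 6 ℤ.* + n)
    D = pochs₃ n * (1# - h (+ 1))
    E = q^k²+k k
    G = poch θ q k
    U = u * u * (q * q)
    T = (1# - q * q * (u * u)) * (1# - q * q * q * (u * u))

  -- Moving head factors to the tail on the right leaves `(y;q)_k (q/y;q)_k` times `1 - yu +
  -- q^(-1/2)y - q^{1/2}u = (1 - q^{1/2}u)(1 + q^(-1/2)y)`, where `u = q^k`. The two products on the
  -- right belong to the cubic expansion at `y` and at `y/q`; this is why the braces of the theorem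
  -- hold two brackets.
  half-power-split : ∀ {y y⁻} → y * y⁻ ≈ 1# → ∀ k →
    (1# - h (+ 1) * q ^ₙ k) * (poch y q k * poch (y⁻ * q) q k) * (1# + y * h (ℤ.- (+ 1)))
      ≈ (1# - y) * (poch (y * q) q k * poch (y⁻ * q) q k)
        - h (+ 1) * (1# - y * h (ℤ.- (+ 2))) * (poch y q k * poch (y⁻ * q * q) q k)
  half-power-split {y} {y⁻} yy⁻≈1 k = sym (begin
    (1# - y) * (poch (y * q) q k * Z) - h₁ * (1# - y * h (ℤ.- (+ 2))) * (X * poch (y⁻ * q * q) q k)
      ≈⟨ +-cong (sym (*-assoc _ _ _)) (-‿cong (*-congʳ coefficient)) ⟩
    (1# - y) * poch (y * q) q k * Z - - (σ * y * (1# - y⁻ * q)) * (X * poch (y⁻ * q * q) q k)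
      ≈⟨ +-cong (*-congʳ (sym (poch-head y q k)))
           (solve 4 (λ a b c d → :- ((:- (a :* b)) :* (c :* d)) := a :* c :* (b :* d)) refl _ _ _ _) ⟩
    X * (1# - y * u) * Z + σ * y * X * ((1# - y⁻ * q) * poch (y⁻ * q * q) q k)
      ≈⟨ +-congˡ (*-congˡ (sym (poch-head (y⁻ * q) q k))) ⟩
    X * (1# - y * u) * Z + σ * y * X * (Z * (1# - y⁻ * q * u))
      ≈⟨ solve 7 (λ X Z y y⁻ σ q u → X :* (𝟙 :- y :* u) :* Z :+ σ :* y :* X :* (Z :* (𝟙 :- y⁻ :* q :* u))
           := X :* Z :* (𝟙 :+ y :* σ :- 𝟙 :* y :* u :- σ :* (y :* y⁻) :* q :* u)) refl X Z y y⁻ σ q u ⟩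
    X * Z * (1# + y * σ - 1# * y * u - σ * (y * y⁻) * q * u)
      ≈⟨ *-congˡ (+-cong (+-congˡ (-‿cong (*-congʳ (*-congʳ (sym h₁σ≈1))))) (-‿cong (*-congʳ
           (trans (*-congʳ (trans (*-congˡ yy⁻≈1) (*-identityʳ σ))) σq≈h₁)))) ⟩
    X * Z * (1# + y * σ - h₁ * σ * y * u - h₁ * u)
      ≈⟨ solve 6 (λ X Z y σ h u → X :* Z :* (𝟙 :+ y :* σ :- h :* σ :* y :* u :- h :* u)
           := (𝟙 :- h :* u) :* (X :* Z) :* (𝟙 :+ y :* σ)) refl X Z y σ h₁ u ⟩
    (1# - h₁ * u) * (X * Z) * (1# + y * σ)  ∎)
    where
    u = q ^ₙ k
    h₁ = h (+ 1)
    σ = h (ℤ.- (+ 1))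
    X = poch y q k
    Z = poch (y⁻ * q) q k
    h₁σ≈1 : h₁ * σ ≈ 1#
    h₁σ≈1 = sym (h-+ (+ 1) (ℤ.- (+ 1)))
    σq≈h₁ : σ * q ≈ h₁
    σq≈h₁ = sym (h-+ (ℤ.- (+ 1)) (+ 2))
    coefficient : h₁ * (1# - y * h (ℤ.- (+ 2))) ≈ - (σ * y * (1# - y⁻ * q))
    coefficient = begin
      h₁ * (1# - y * h (ℤ.- (+ 2)))
        ≈⟨ solve 3 (λ h y g → h :* (𝟙 :- y :* g) := h :- y :* (h :* g)) refl h₁ y _ ⟩
      h₁ - y * (h₁ * h (ℤ.- (+ 2)))
        ≈⟨ +-cong (sym (trans (*-congʳ (trans (*-congˡ yy⁻≈1) (*-identityʳ σ))) σq≈h₁))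
             (-‿cong (*-congˡ (sym (h-+ (+ 1) (ℤ.- (+ 2)))))) ⟩
      σ * (y * y⁻) * q - y * σ
        ≈⟨ solve 4 (λ σ y y⁻ q → σ :* (y :* y⁻) :* q :- y :* σ := :- (σ :* y :* (𝟙 :- y⁻ :* q))) refl σ y y⁻ q ⟩
      - (σ * y * (1# - y⁻ * q))  ∎

-- From general ℓ to ℓ = 0: the very-well-poised expansion.

module WellPoised {c ℓ : Level} (F : ComplexField c ℓ) (s : ComplexField.Carrier F)
    (s≉0 : ¬ (ComplexField._≈_ F s (ComplexField.0# F))) where
  open ComplexField F hiding (zero)
  open Notation F
  open FieldLemmas F
  open Powers F s s≉0
  open CubicExpansion F s s≉0 using (q)
  open IntegerCoefficientSolver commRing using (solve; _:=_; _:+_; _:*_; _:-_; :-_; 𝟙)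
  open import Relation.Binary.Reasoning.Setoid setoid

  ^ₙ-+ : ∀ m n → q ^ₙ (m ℕ.+ n) ≈ q ^ₙ m * q ^ₙ n
  ^ₙ-+ zero n = sym (*-identityˡ _)
  ^ₙ-+ (suc m) n = trans (*-congʳ (^ₙ-+ m n))
    (solve 3 (λ a b q → a :* b :* q := a :* q :* b) refl _ _ q)

  -- This is `(-1)^i q^{li} (q^(-l);q)_i` with sign and power absorbed. It vanishes for `i > l`.
  differences : ℕ → ℕ → Carrier
  differences l zero = 1#
  differences l (suc i) = differences l i * (q ^ₙ i - q ^ₙ l)

  -- The factor at `j = 0` is `1 - q^{l+1}`; each of the other `i` factors contributes one `q`.
  differences-suc : ∀ l i → differences (suc l) (suc i) ≈ differences l i * q ^ₙ i * (1# - q ^ₙ l * q)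
  differences-suc l zero = solve 2 (λ p q → 𝟙 :* (𝟙 :- p :* q) := 𝟙 :* 𝟙 :* (𝟙 :- p :* q)) refl (q ^ₙ l) q
  differences-suc l (suc i) = trans (*-congʳ (differences-suc l i))
    (solve 4 (λ d r p q → d :* r :* (𝟙 :- p :* q) :* (r :* q :- p :* q) := d :* (r :- p) :* (r :* q) :* (𝟙 :- p :* q))
      refl (differences l i) (q ^ₙ i) (q ^ₙ l) q)

  -- With a = x²/q, G l i a is [x,−x; x²,−1]_l times the i-th coefficient on the
  -- right side of the theorem, with the braces and the factor 1/(1 − q^{1/2}) removed
  -- and multiplied by (−1;q)_l.
  numerator denominator G : ℕ → ℕ → Carrier → Carrier
  numerator l i a = poch (a * q) (q * q) l * differences l i * (1# - a * (q ^ₙ i * q ^ₙ i)) * poch a q i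
  denominator l i a = poch a q (suc (l ℕ.+ i)) * poch q q i
  G l i a = numerator l i a * denominator l i a ⁻¹

  G-zero-suc : ∀ l a → denominator (suc l) 0 a ≉0 →
    (1# - a * q * q ^ₙ l) * G (suc l) 0 a ≈ (1# - a * q * (q ^ₙ l * q ^ₙ l)) * G l 0 a
  G-zero-suc l a d≉0 = *-cancelʳ-≉0 d≉0 (begin
    (1# - a * q * p) * G (suc l) 0 a * (poch a q (suc m) * (1# - a * (q ^ₙ m * q)) * 1#)
      ≈⟨ trans (*-assoc _ _ _) (*-congˡ (⁻¹-*-cancel d≉0)) ⟩
    (1# - a * q * p) * (V * (1# - a * q * (q * q) ^ₙ l) * 1# * (1# - a * (1# * 1#)) * 1#)
      ≈⟨ *-congˡ (*-congʳ (*-congʳ (*-congʳ (*-congˡ (+-congˡ (-‿cong (*-congˡ (^ₙ-distrib-* q q l)))))))) ⟩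
    (1# - a * q * p) * (V * (1# - a * q * (p * p)) * 1# * (1# - a * (1# * 1#)) * 1#)
      ≈⟨ solve 4 (λ a q p V → (𝟙 :- a :* q :* p) :* (V :* (𝟙 :- a :* q :* (p :* p)) :* 𝟙 :* (𝟙 :- a :* (𝟙 :* 𝟙)) :* 𝟙)
           := (𝟙 :- a :* q :* (p :* p)) :* (V :* 𝟙 :* (𝟙 :- a :* (𝟙 :* 𝟙)) :* 𝟙) :* (𝟙 :- a :* (p :* 𝟙 :* q)))
           refl a q p V ⟩
    (1# - a * q * (p * p)) * numerator l 0 a * (1# - a * (p * 1# * q))
      ≈⟨ *-cong (*-congˡ (⁻¹-*-cancel d₁≉0)) (+-congˡ (-‿cong (*-congˡ (*-congʳ (^ₙ-+ l 0))))) ⟨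
    (1# - a * q * (p * p)) * (G l 0 a * (poch a q (suc m) * 1#)) * (1# - a * (q ^ₙ m * q))
      ≈⟨ solve 4 (λ A g P b → A :* (g :* (P :* 𝟙)) :* b := A :* g :* (P :* b :* 𝟙)) refl _ (G l 0 a) (poch a q (suc m)) _ ⟩
    (1# - a * q * (p * p)) * G l 0 a * (poch a q (suc m) * (1# - a * (q ^ₙ m * q)) * 1#)  ∎)
    where
    m = l ℕ.+ 0
    p = q ^ₙ l
    V = poch (a * q) (q * q) l
    d₁≉0 : denominator l 0 a ≉0
    d₁≉0 = ≉0-resp (sym (*-identityʳ _)) (*-≉0ˡ (*-≉0ˡ d≉0))

  -- The relation of `Φ-contiguous`, read off coefficient by coefficient: `x` to `xq` sends `a` to
  -- `aq²` and, by `basis-shift`, index `j` to `j+1`.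
  G-suc-suc : ∀ l j a → poch a q (suc (suc (suc (l ℕ.+ j)))) ≉0 → poch q q (suc j) ≉0 →
    (1# - a * q * q ^ₙ l) * G (suc l) (suc j) a
      ≈ (1# - a * q * (q ^ₙ l * q ^ₙ l)) * G l (suc j) a + (1# - a * q) * q ^ₙ l * G l j (a * (q * q))
  G-suc-suc l j a P≉0 R≉0 = *-cancelʳ-≉0 D≉0 (begin
    (1# - a * q * p) * G (suc l) (suc j) a * D
      ≈⟨ trans (*-assoc _ _ _) (*-congˡ g′) ⟩
    (1# - a * q * p) * (V * W * (π * r * (1# - p * q)) * e * A)
      -- Up to common factors this says `r(1 - apq)(1 - pq) = (r - p)(1 - aprq²) + p(1 - arq)(1 -
      -- rq)`.
      ≈⟨ solve 8 (λ a q p r V π e A →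
           let W = 𝟙 :- a :* q :* (p :* p) in
           (𝟙 :- a :* q :* p) :* (V :* W :* (π :* r :* (𝟙 :- p :* q)) :* e :* A)
           := W :* (V :* (π :* (r :- p)) :* e :* A :* (𝟙 :- a :* (p :* r :* q :* q)))
              :+ p :* (V :* W :* π :* e :* (A :* (𝟙 :- a :* (r :* q))) :* (𝟙 :- q :* r)))
           refl a q p r V π e A ⟩
    W * (V * (π * (r - p)) * e * A * (1# - a * (p * r * q * q)))
      + p * (V * W * π * e * (A * (1# - a * (r * q))) * (1# - q * r))
      ≈⟨ +-cong (*-congˡ g₁) (*-congˡ g₂) ⟨
    W * (G l (suc j) a * D) + p * ((1# - a * q) * (G l j (a * (q * q)) * D))
      ≈⟨ solve 6 (λ W g D p b g′ → W :* (g :* D) :+ p :* (b :* (g′ :* D)) := (W :* g :+ b :* p :* g′) :* D)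
           refl W (G l (suc j) a) D p (1# - a * q) (G l j (a * (q * q))) ⟩
    (W * G l (suc j) a + (1# - a * q) * p * G l j (a * (q * q))) * D  ∎)
    where
    m = l ℕ.+ j
    D = poch a q (suc (suc (suc m))) * poch q q (suc j)
    D≉0 : D ≉0
    D≉0 = *-≉0 P≉0 R≉0
    p = q ^ₙ l
    r = q ^ₙ j
    V = poch (a * q) (q * q) l
    W = 1# - a * q * (p * p)
    π = differences l j
    e = 1# - a * (r * q * (r * q))
    A = poch a q (suc j)
    V-suc : poch (a * q) (q * q) (suc l) ≈ V * W
    V-suc = *-congˡ (+-congˡ (-‿cong (*-congˡ (^ₙ-distrib-* q q l))))
    poch-tail : poch a q (suc (suc (suc m))) ≈ poch a q (suc (suc m)) * (1# - a * (p * r * q * q))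
    poch-tail = *-congˡ (+-congˡ (-‿cong (*-congˡ (*-congʳ (*-congʳ (^ₙ-+ l j))))))
    -- Factorials at `aq²` are tails of those at `a`, so `D` is a common denominator of all three
    -- terms.
    two-heads : ∀ k → (1# - a) * (1# - a * q) * poch (a * (q * q)) q k ≈ poch a q (suc (suc k))
    two-heads k = sym (begin
      poch a q (suc (suc k))                                  ≈⟨ poch-head a q (suc k) ⟩
      (1# - a) * poch (a * q) q (suc k)                       ≈⟨ *-congˡ (poch-head (a * q) q k) ⟩
      (1# - a) * ((1# - a * q) * poch (a * q * q) q k)        ≈⟨ *-assoc _ _ _ ⟨
      (1# - a) * (1# - a * q) * poch (a * q * q) q k          ≈⟨ *-congˡ (poch-congˡ (*-assoc a q q) k) ⟩
      (1# - a) * (1# - a * q) * poch (a * (q * q)) q k        ∎)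
    g′ : G (suc l) (suc j) a * D ≈ V * W * (π * r * (1# - p * q)) * e * A
    g′ = begin
      G (suc l) (suc j) a * D
        ≡⟨ ≡.cong (λ i → G (suc l) (suc j) a * (poch a q (suc (suc i)) * poch q q (suc j))) (ℕₚ.+-suc l j) ⟨
      G (suc l) (suc j) a * denominator (suc l) (suc j) a
        ≈⟨ ⁻¹-*-cancel (≡.subst (λ i → poch a q (suc (suc i)) * poch q q (suc j) ≉0) (≡.sym (ℕₚ.+-suc l j)) D≉0) ⟩
      numerator (suc l) (suc j) a
        ≈⟨ *-congʳ (*-congʳ (*-cong V-suc (differences-suc l j))) ⟩
      V * W * (π * r * (1# - p * q)) * e * A  ∎
    g₁ : G l (suc j) a * D ≈ V * (π * (r - p)) * e * A * (1# - a * (p * r * q * q))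
    g₁ = begin
      G l (suc j) a * D
        ≈⟨ *-congˡ (*-congʳ poch-tail) ⟩
      G l (suc j) a * (poch a q (suc (suc m)) * (1# - a * (p * r * q * q)) * poch q q (suc j))
        ≈⟨ solve 4 (λ g P b R → g :* (P :* b :* R) := g :* (P :* R) :* b) refl _ _ _ _ ⟩
      G l (suc j) a * (poch a q (suc (suc m)) * poch q q (suc j)) * (1# - a * (p * r * q * q))
        ≡⟨ ≡.cong (λ i → G l (suc j) a * (poch a q (suc i) * poch q q (suc j)) * (1# - a * (p * r * q * q))) (ℕₚ.+-suc l j) ⟨
      G l (suc j) a * denominator l (suc j) a * (1# - a * (p * r * q * q))
        ≈⟨ *-congʳ (⁻¹-*-cancel (≡.subst (λ i → poch a q (suc i) * poch q q (suc j) ≉0) (≡.sym (ℕₚ.+-suc l j))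
             (*-≉0 (*-≉0ˡ P≉0) R≉0))) ⟩
      V * (π * (r - p)) * e * A * (1# - a * (p * r * q * q))  ∎
    d₂≉0 : denominator l j (a * (q * q)) ≉0
    d₂≉0 = *-≉0 (*-≉0ʳ (≉0-resp (sym (two-heads (suc m))) P≉0)) (*-≉0ˡ R≉0)
    g₂ : (1# - a * q) * (G l j (a * (q * q)) * D) ≈ V * W * π * e * (A * (1# - a * (r * q))) * (1# - q * r)
    g₂ = begin
      (1# - a * q) * (G l j (a * (q * q)) * D)
        ≈⟨ *-congˡ (*-congˡ (*-congʳ (two-heads (suc m)))) ⟨
      (1# - a * q) * (G l j (a * (q * q)) * ((1# - a) * (1# - a * q) * poch (a * (q * q)) q (suc m) * (poch q q j * (1# - q * r))))
        ≈⟨ solve 6 (λ b g c P R d → b :* (g :* (c :* b :* P :* (R :* d))) := b :* (c :* b) :* (g :* (P :* R)) :* d) refl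
             (1# - a * q) (G l j (a * (q * q))) (1# - a) _ _ _ ⟩
      (1# - a * q) * ((1# - a) * (1# - a * q)) * (G l j (a * (q * q)) * denominator l j (a * (q * q))) * (1# - q * r)
        ≈⟨ *-congʳ (*-congˡ (⁻¹-*-cancel d₂≉0)) ⟩
      (1# - a * q) * ((1# - a) * (1# - a * q)) * numerator l j (a * (q * q)) * (1# - q * r)
        ≈⟨ *-congʳ (solve 6 (λ b c V′ π e′ A′ → b :* c :* (V′ :* π :* e′ :* A′) := b :* V′ :* π :* e′ :* (c :* A′)) refl
             (1# - a * q) ((1# - a) * (1# - a * q)) _ π _ _) ⟩
      (1# - a * q) * poch (a * (q * q) * q) (q * q) l * π * (1# - a * (q * q) * (r * r))
        * ((1# - a) * (1# - a * q) * poch (a * (q * q)) q j) * (1# - q * r)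
        ≈⟨ *-congʳ (*-cong (*-cong (*-congʳ V₂) (solve 3 (λ a q r → 𝟙 :- a :* (q :* q) :* (r :* r)
             := 𝟙 :- a :* (r :* q :* (r :* q))) refl a q r)) (two-heads j)) ⟩
      V * W * π * e * (A * (1# - a * (r * q))) * (1# - q * r)  ∎
      where
      V₂ : (1# - a * q) * poch (a * (q * q) * q) (q * q) l ≈ V * W
      V₂ = trans (*-congˡ (poch-congˡ (solve 2 (λ a q → a :* (q :* q) :* q := a :* q :* (q :* q)) refl a q) l))
        (trans (sym (poch-head (a * q) (q * q) l)) V-suc)

  G-top : ∀ l a → G l (suc l) a ≈ 0#
  G-top l a = trans (*-congʳ (trans (*-congʳ (trans (*-congʳ (trans (*-congˡ
    (trans (*-congˡ (-‿inverseʳ (q ^ₙ l))) (zeroʳ _))) (zeroʳ _))) (zeroˡ _))) (zeroˡ _))) (zeroˡ _)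

  -- Π_{j<l} (q^j + q^k) = (−1;q)_l (−q;q)_k / (−q^{1−l};q)_k, free of denominators.
  powerSums : ℕ → ℕ → Carrier
  powerSums zero k = 1#
  powerSums (suc l) k = powerSums l k * (q ^ₙ l + q ^ₙ k)

  -- The `x`-dependent factors of the left summand over `(-q^{1-l};q)_k`, multiplied by
  -- `(-1;q)_l (-q;q)_k` to clear that denominator. The inverse `x⁻` is a separate argument, so that
  -- the shift to `xq` needs no law for `_⁻¹`.
  Φ : ℕ → Carrier → Carrier → ℕ → Carrier
  Φ l x x⁻ k = poch x q k * poch (h (+ 2 ℤ.- + 2 ℤ.* + l) * x⁻) q k * powerSums l k

  basis : Carrier → Carrier → ℕ → ℕ → Carrier
  basis x x⁻ k i = poch (x * q ^ₙ i) q k * poch (h (+ 2 ℤ.- + 2 ℤ.* + i) * x⁻) q k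

  h-2-2*suc : ∀ l → h (+ 2 ℤ.- + 2 ℤ.* + l) ≈ h (+ 2 ℤ.- + 2 ℤ.* + suc l) * q
  h-2-2*suc l = h-split (+ 2 ℤ.- + 2 ℤ.* + suc l) (+ 2) (step (+ l))
    where
    step : ∀ i → + 2 ℤ.- + 2 ℤ.* i ≡ + 2 ℤ.- + 2 ℤ.* (+ 1 ℤ.+ i) ℤ.+ + 2
    step = solve-∀

  h-2-2*-shift : ∀ l x⁻ → h (+ 2 ℤ.- + 2 ℤ.* + l) * (x⁻ * h (ℤ.- (+ 2))) ≈ h (+ 2 ℤ.- + 2 ℤ.* + suc l) * x⁻
  h-2-2*-shift l x⁻ = trans
    (solve 3 (λ a b c → a :* (b :* c) := a :* c :* b) refl _ x⁻ _)
    (*-congʳ (sym (h-split (+ 2 ℤ.- + 2 ℤ.* + l) (ℤ.- (+ 2)) (step (+ l)))))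
    where
    step : ∀ i → + 2 ℤ.- + 2 ℤ.* (+ 1 ℤ.+ i) ≡ + 2 ℤ.- + 2 ℤ.* i ℤ.+ ℤ.- (+ 2)
    step = solve-∀

  basis-shift : ∀ x x⁻ k i → basis (x * q) (x⁻ * h (ℤ.- (+ 2))) k i ≈ basis x x⁻ k (suc i)
  basis-shift x x⁻ k i = *-cong
    (poch-congˡ (solve 3 (λ x q r → x :* q :* r := x :* (r :* q)) refl x q (q ^ₙ i)) k)
    (poch-congˡ (h-2-2*-shift i x⁻) k)

  -- With `t = q^(-l)/x` all three terms are multiples of `(x;q)_k (t;q)_k powerSums l k`. What
  -- remains is `(1 + x)p(1 - xu) - (1 + px)(px - u) = (1 - x²p)(p + u)`, and `p +
  -- u` is the next factor of `powerSums`.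
  Φ-contiguous : ∀ {x x⁻} → x * x⁻ ≈ 1# → ∀ l k →
    (1# - x * x * q ^ₙ l) * Φ (suc l) x x⁻ k
      ≈ (1# - x * x * (q ^ₙ l * q ^ₙ l)) * Φ l x x⁻ k
        + (1# - x * x) * q ^ₙ l * Φ l (x * q) (x⁻ * h (ℤ.- (+ 2))) k
  Φ-contiguous {x} {x⁻} xx⁻≈1 l k = sym (begin
    (1# - x * x * (p * p)) * (a * poch (h (+ 2 ℤ.- + 2 ℤ.* + l) * x⁻) q k * S)
      + (1# - x * x) * p * (a′ * poch (h (+ 2 ℤ.- + 2 ℤ.* + l) * (x⁻ * h (ℤ.- (+ 2)))) q k * S)
      ≈⟨ +-cong (*-congˡ (*-congʳ (*-congˡ (poch-congˡ tq≈ k)))) (*-congˡ (*-congʳ (*-congˡ (poch-congˡ (h-2-2*-shift l x⁻) k)))) ⟩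
    (1# - x * x * (p * p)) * (a * b′ * S) + (1# - x * x) * p * (a′ * b * S)
      ≈⟨ solve 7 (λ x p a b′ S a′ b → (𝟙 :- x :* x :* (p :* p)) :* (a :* b′ :* S) :+ (𝟙 :- x :* x) :* p :* (a′ :* b :* S)
           := (:- (a :* S :* (𝟙 :+ p :* x))) :* ((p :* x :- 𝟙) :* b′) :+ (𝟙 :+ x) :* p :* S :* b :* ((𝟙 :- x) :* a′))
           refl x p a b′ S a′ b ⟩
    - (a * S * (1# + p * x)) * ((p * x - 1#) * b′) + (1# + x) * p * S * b * ((1# - x) * a′)
      ≈⟨ +-cong (*-congˡ b-shift) (*-congˡ (sym (poch-head x q k))) ⟩
    - (a * S * (1# + p * x)) * ((p * x - u) * b) + (1# + x) * p * S * b * (a * (1# - x * u))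
      ≈⟨ solve 6 (λ x p a S b u → (:- (a :* S :* (𝟙 :+ p :* x))) :* ((p :* x :- u) :* b)
             :+ (𝟙 :+ x) :* p :* S :* b :* (a :* (𝟙 :- x :* u))
           := (𝟙 :- x :* x :* p) :* (a :* b :* (S :* (p :+ u)))) refl x p a S b u ⟩
    (1# - x * x * p) * Φ (suc l) x x⁻ k  ∎)
    where
    p = q ^ₙ l
    u = q ^ₙ k
    S = powerSums l k
    t = h (+ 2 ℤ.- + 2 ℤ.* + suc l) * x⁻
    a = poch x q k
    a′ = poch (x * q) q k
    b = poch t q k
    b′ = poch (t * q) q k
    tq≈ : h (+ 2 ℤ.- + 2 ℤ.* + l) * x⁻ ≈ t * q
    tq≈ = trans (*-congʳ (h-2-2*suc l)) (solve 3 (λ a b c → a :* b :* c := a :* c :* b) refl _ q x⁻)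
    pxt≈1 : p * x * t ≈ 1#
    pxt≈1 = begin
      p * x * t
        ≈⟨ solve 4 (λ p x h x⁻ → p :* x :* (h :* x⁻) := p :* h :* (x :* x⁻)) refl p x _ x⁻ ⟩
      p * h (+ 2 ℤ.- + 2 ℤ.* + suc l) * (x * x⁻)
        ≈⟨ *-cong (*-congʳ (h-^ₙ (+ 2) l)) xx⁻≈1 ⟩
      h (+ 2 ℤ.* + l) * h (+ 2 ℤ.- + 2 ℤ.* + suc l) * 1#
        ≈⟨ trans (*-identityʳ _) (sym (h-split (+ 2 ℤ.* + l) _ (step (+ l)))) ⟩
      1#  ∎
      where
      step : ∀ i → + 0 ≡ + 2 ℤ.* i ℤ.+ (+ 2 ℤ.- + 2 ℤ.* (+ 1 ℤ.+ i))
      step = solve-∀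
    b-shift : (p * x - 1#) * b′ ≈ (p * x - u) * b
    b-shift = begin
      (p * x - 1#) * b′                          ≈⟨ *-congʳ (+-congˡ (-‿cong pxt≈1)) ⟨
      (p * x - p * x * t) * b′                   ≈⟨ solve 3 (λ a t b → (a :- a :* t) :* b := a :* ((𝟙 :- t) :* b)) refl (p * x) t b′ ⟩
      p * x * ((1# - t) * b′)                    ≈⟨ *-congˡ (sym (poch-head t q k)) ⟩
      p * x * (b * (1# - t * u))                 ≈⟨ solve 4 (λ a b t u → a :* (b :* (𝟙 :- t :* u)) := (a :- a :* t :* u) :* b) refl (p * x) b t u ⟩
      (p * x - p * x * t * u) * b                ≈⟨ *-congʳ (+-congˡ (-‿cong (trans (*-congʳ pxt≈1) (*-identityˡ u)))) ⟩
      (p * x - u) * b                            ∎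

  -- The sum over i is a terminating very-well-poised ₆φ₅ in base a = x²/q; it
  -- is summed by matching the contiguous relations of both sides in l.
  connection : ∀ l {x x⁻ a} → x * x⁻ ≈ 1# → a * q ≈ x * x →
    poch a q (suc (l ℕ.+ l)) ≉0 → poch q q l ≉0 → ∀ k →
    Φ l x x⁻ k ≈ sumTo l (λ i → G l i a * basis x x⁻ k i)
  connection zero {x} {x⁻} {a} xx⁻≈1 aq≈xx P≉0 R≉0 k = sym (begin
    G 0 0 a * (poch (x * 1#) q k * B)      ≈⟨ *-cong G≈1 (*-congʳ (poch-congˡ (*-identityʳ x) k)) ⟩
    1# * (poch x q k * B)                  ≈⟨ *-comm _ _ ⟩
    poch x q k * B * 1#                    ∎)
    where
    B = poch (h (+ 2 ℤ.- + 2 ℤ.* + 0) * x⁻) q k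
    G≈1 : G 0 0 a ≈ 1#
    G≈1 = trans (*-congʳ (solve 1 (λ a → 𝟙 :* 𝟙 :* (𝟙 :- a :* (𝟙 :* 𝟙)) :* 𝟙 := 𝟙 :* (𝟙 :- a :* 𝟙) :* 𝟙) refl a))
      (inverse _ (*-≉0 P≉0 R≉0))
  connection (suc l) {x} {x⁻} {a} xx⁻≈1 aq≈xx P≉0 R≉0 k = *-cancelʳ-≉0 c≉0 (begin
    Φ (suc l) x x⁻ k * (1# - a * q * p)
      ≈⟨ trans (*-comm _ _) (*-congʳ (+-congˡ (-‿cong (*-congʳ aq≈xx)))) ⟩
    (1# - x * x * p) * Φ (suc l) x x⁻ k
      ≈⟨ Φ-contiguous xx⁻≈1 l k ⟩
    (1# - x * x * (p * p)) * Φ l x x⁻ k + (1# - x * x) * p * Φ l (x * q) (x⁻ * h (ℤ.- (+ 2))) k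
      ≈⟨ +-cong (*-cong (+-congˡ (-‿cong (*-congʳ (sym aq≈xx)))) (connection l xx⁻≈1 aq≈xx P₁≉0 (*-≉0ˡ R≉0) k))
           (*-cong (*-congʳ (+-congˡ (-‿cong (sym aq≈xx)))) (connection l shifted-pair shifted-square P₂≉0 (*-≉0ˡ R≉0) k)) ⟩
    W * sumTo l (λ i → G l i a * f i)
      + (1# - a * q) * p * sumTo l (λ i → G l i (a * (q * q)) * basis (x * q) (x⁻ * h (ℤ.- (+ 2))) k i)
      -- `G-top` extends the first sum to `l+1`, and `basis-shift` rewrites the second in the basis
      -- of `x`; the sums can then be compared index by index.
      ≈⟨ +-cong (trans (*-congˡ (sym (trans (+-congˡ (trans (*-congʳ (G-top l a)) (zeroˡ _))) (+-identityʳ _)))) (sumTo-*ˡ (suc l) W _))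
           (trans (sumTo-*ˡ l _ _) (sumTo-cong l λ i _ → trans (*-congˡ (*-congˡ (basis-shift x x⁻ k i))) (sym (*-assoc _ _ _)))) ⟩
    sumTo (suc l) (λ i → W * (G l i a * f i)) + sumTo l (λ i → (1# - a * q) * p * G l i (a * (q * q)) * f (suc i))
      ≈⟨ +-congʳ (sumTo-head l _) ⟩
    W * (G l 0 a * f 0) + sumTo l (λ i → W * (G l (suc i) a * f (suc i)))
      + sumTo l (λ i → (1# - a * q) * p * G l i (a * (q * q)) * f (suc i))
      ≈⟨ trans (+-assoc _ _ _) (+-congˡ (sym (sumTo-+ l _ _))) ⟩
    W * (G l 0 a * f 0) + sumTo l (λ i → W * (G l (suc i) a * f (suc i)) + (1# - a * q) * p * G l i (a * (q * q)) * f (suc i))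
      ≈⟨ +-cong head (sumTo-cong l tail) ⟩
    G (suc l) 0 a * f 0 * (1# - a * q * p) + sumTo l (λ i → G (suc l) (suc i) a * f (suc i) * (1# - a * q * p))
      ≈⟨ sumTo-head l (λ i → G (suc l) i a * f i * (1# - a * q * p)) ⟨
    sumTo (suc l) (λ i → G (suc l) i a * f i * (1# - a * q * p))
      ≈⟨ sumTo-*ʳ (suc l) _ _ ⟨
    sumTo (suc l) (λ i → G (suc l) i a * f i) * (1# - a * q * p)  ∎)
    where
    p = q ^ₙ l
    W = 1# - a * q * (p * p)
    f = basis x x⁻ k
    -- Of these `2l+3` factors, dropping the last two gives the condition needed at `a`, and
    -- dropping the first two the one needed at `aq²`.
    P′≉0 : poch a q (suc (suc (suc (l ℕ.+ l)))) ≉0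
    P′≉0 = ≡.subst (λ i → poch a q (suc (suc i)) ≉0) (ℕₚ.+-suc l l) P≉0
    P₁≉0 : poch a q (suc (l ℕ.+ l)) ≉0
    P₁≉0 = *-≉0ˡ (*-≉0ˡ P′≉0)
    P₂≉0 : poch (a * (q * q)) q (suc (l ℕ.+ l)) ≉0
    P₂≉0 = ≉0-resp (poch-congˡ (*-assoc a q q) (suc (l ℕ.+ l))) (*-≉0ʳ (≉0-resp (poch-head (a * q) q (suc (l ℕ.+ l)))
      (*-≉0ʳ (≉0-resp (poch-head a q (suc (suc (l ℕ.+ l)))) P′≉0))))
    c≉0 : 1# - a * q * p ≉0
    c≉0 = ≉0-resp (+-congˡ (-‿cong (solve 3 (λ a p q → a :* (p :* q) := a :* q :* p) refl a p q)))
      (*-≉0ʳ (poch-≉0-≤ {m = suc (suc l)} (ℕ.s≤s (ℕ.s≤s (ℕₚ.m≤n⇒m≤1+n (ℕₚ.m≤m+n l l)))) P′≉0))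
    shifted-pair : x * q * (x⁻ * h (ℤ.- (+ 2))) ≈ 1#
    shifted-pair = trans (solve 4 (λ x q y g → x :* q :* (y :* g) := x :* y :* (q :* g)) refl x q x⁻ _)
      (trans (*-cong xx⁻≈1 (sym (h-+ (+ 2) (ℤ.- (+ 2))))) (*-identityˡ 1#))
    shifted-square : a * (q * q) * q ≈ x * q * (x * q)
    shifted-square = trans (solve 2 (λ a q → a :* (q :* q) :* q := a :* q :* (q :* q)) refl a q)
      (trans (*-congʳ aq≈xx) (solve 2 (λ x q → x :* x :* (q :* q) := x :* q :* (x :* q)) refl x q))
    head : W * (G l 0 a * f 0) ≈ G (suc l) 0 a * f 0 * (1# - a * q * p)
    head = trans (sym (*-assoc _ _ _)) (trans (*-congʳ (sym (G-zero-suc l a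
      (≉0-resp (sym (*-identityʳ _)) (poch-≉0-≤ (ℕ.s≤s (ℕ.s≤s (ℕₚ.+-monoʳ-≤ l ℕ.z≤n))) P≉0)))))
      (solve 3 (λ a b c → a :* b :* c := b :* c :* a) refl _ _ _))
    tail : ∀ i → i ℕ.≤ l → W * (G l (suc i) a * f (suc i)) + (1# - a * q) * p * G l i (a * (q * q)) * f (suc i)
      ≈ G (suc l) (suc i) a * f (suc i) * (1# - a * q * p)
    tail i i≤l = trans (solve 4 (λ W g f b → W :* (g :* f) :+ b :* f := (W :* g :+ b) :* f) refl W _ (f (suc i)) _)
      (trans (*-congʳ (sym (G-suc-suc l i a
        (poch-≉0-≤ (ℕ.s≤s (ℕ.s≤s (ℕ.s≤s (ℕₚ.+-monoʳ-≤ l i≤l)))) P′≉0) (poch-≉0-≤ (ℕ.s≤s i≤l) R≉0))))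
        (solve 3 (λ a b c → a :* b :* c := b :* c :* a) refl _ _ _))

-- Translation of the theorem's factorials into division-free products.

module Transformation {c ℓ : Level} (F : ComplexField c ℓ) (s : ComplexField.Carrier F)
    (s≉0 : ¬ (ComplexField._≈_ F s (ComplexField.0# F))) where
  open ComplexField F hiding (zero)
  open Notation F
  open FieldLemmas F
  open Powers F s s≉0
  open CubicExpansion F s s≉0 hiding (r; t; w)
  open WellPoised F s s≉0
  open IntegerCoefficientSolver commRing using (solve; _:=_; _:+_; _:*_; _:-_; :-_; 𝟙)
  open import Relation.Binary.Reasoning.Setoid setoid

  unit-≉0 : ∀ {a b} → a * b ≈ 1# → a ≉0
  unit-≉0 ab≈1 a≈0 = char0 0 (trans (+-identityʳ 1#) (trans (sym ab≈1) (trans (*-congʳ a≈0) (zeroˡ _))))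

  prodPoch-≉0-≤ : ∀ as {p m n} → m ℕ.≤ n → prodPoch as p n ≉0 → prodPoch as p m ≉0
  prodPoch-≉0-≤ [] m≤n nz = nz
  prodPoch-≉0-≤ (a ∷ as) m≤n nz = *-≉0 (poch-≉0-≤ m≤n (*-≉0ˡ nz)) (prodPoch-≉0-≤ as m≤n (*-≉0ʳ nz))

  powerSums-zeroʳ : ∀ l → powerSums l 0 ≈ poch (- 1#) q l
  powerSums-zeroʳ zero = refl
  powerSums-zeroʳ (suc l) = *-cong (powerSums-zeroʳ l) (solve 1 (λ p → p :+ 𝟙 := 𝟙 :- (:- 𝟙) :* p) refl (q ^ₙ l))

  -- The factor at `j = 0` is `1 + q^{k+1}`; each later one is `q` times a factor of
  -- `powerSums l k`.
  powerSums-suc-suc : ∀ l k → powerSums (suc l) (suc k) ≈ (1# + q ^ₙ suc k) * q ^ₙ l * powerSums l k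
  powerSums-suc-suc zero k = solve 1 (λ v → 𝟙 :* (𝟙 :+ v) := (𝟙 :+ v) :* 𝟙 :* 𝟙) refl (q ^ₙ suc k)
  powerSums-suc-suc (suc l) k = trans (*-congʳ (powerSums-suc-suc l k))
    (solve 4 (λ p u q S → (𝟙 :+ u :* q) :* p :* S :* (p :* q :+ u :* q) := (𝟙 :+ u :* q) :* (p :* q) :* (S :* (p :+ u)))
      refl (q ^ₙ l) (q ^ₙ k) q (powerSums l k))

  powerSums-poch : ∀ l k →
    poch (- q) q k * poch (- 1#) q l ≈ poch (- h (+ 2 ℤ.- + 2 ℤ.* + l)) q k * powerSums l k
  powerSums-poch l zero = *-congˡ (sym (powerSums-zeroʳ l))
  powerSums-poch l (suc k) = begin
    poch (- q) q k * (1# - (- q) * u) * poch (- 1#) q l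
      ≈⟨ solve 3 (λ a b c → a :* b :* c := a :* c :* b) refl _ _ _ ⟩
    poch (- q) q k * poch (- 1#) q l * (1# - (- q) * u)
      ≈⟨ *-congʳ (powerSums-poch l k) ⟩
    poch (- g) q k * S * (1# - (- q) * u)
      ≈⟨ *-assoc _ _ _ ⟩
    poch (- g) q k * (S * (1# - (- q) * u))
      -- The comparison is made after multiplying by the unit `q^l`, which turns `1 + q^{1-l+k}`
      -- into `q^l + q^{k+1}`, the top factor of `powerSums (suc l) (suc k)`.
      ≈⟨ *-congˡ (*-cancelʳ-≉0 (unit-≉0 {b = h (ℤ.- (+ 2 ℤ.* + l))} pp⁻≈1) raise) ⟩
    poch (- g) q k * ((1# - (- g) * u) * powerSums l (suc k))
      ≈⟨ *-assoc _ _ _ ⟨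
    poch (- g) q k * (1# - (- g) * u) * powerSums l (suc k)  ∎
    where
    g = h (+ 2 ℤ.- + 2 ℤ.* + l)
    u = q ^ₙ k
    p = q ^ₙ l
    S = powerSums l k
    pp⁻≈1 : p * h (ℤ.- (+ 2 ℤ.* + l)) ≈ 1#
    pp⁻≈1 = trans (*-congʳ (h-^ₙ (+ 2) l)) (sym (h-split (+ 2 ℤ.* + l) _ (≡.sym (ℤₚ.+-inverseʳ (+ 2 ℤ.* + l)))))
    gp≈q : g * p ≈ q
    gp≈q = trans (*-congˡ (h-^ₙ (+ 2) l)) (sym (h-split g′ _ (step (+ l))))
      where
      g′ = + 2 ℤ.- + 2 ℤ.* + l
      step : ∀ i → + 2 ≡ + 2 ℤ.- + 2 ℤ.* i ℤ.+ + 2 ℤ.* i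
      step = solve-∀
    raise : S * (1# - (- q) * u) * p ≈ (1# - (- g) * u) * powerSums l (suc k) * p
    raise = begin
      S * (1# - (- q) * u) * p
        ≈⟨ solve 4 (λ S q u p → S :* (𝟙 :- (:- q) :* u) :* p := (𝟙 :+ u :* q) :* p :* S) refl S q u p ⟩
      (1# + u * q) * p * S                                  ≈⟨ powerSums-suc-suc l k ⟨
      powerSums l (suc k) * (p + u * q)                     ≈⟨ *-congˡ (+-congˡ (*-congˡ gp≈q)) ⟨
      powerSums l (suc k) * (p + u * (g * p))
        ≈⟨ solve 4 (λ S p u g → S :* (p :+ u :* (g :* p)) := (𝟙 :- (:- g) :* u) :* S :* p) refl _ p u g ⟩
      (1# - (- g) * u) * powerSums l (suc k) * p            ∎

  poch-*-poch-neg : ∀ y l → poch y q l * poch (- y) q l ≈ poch (y * y) (q * q) l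
  poch-*-poch-neg y zero = *-identityˡ _
  poch-*-poch-neg y (suc l) = begin
    poch y q l * (1# - y * p) * (poch (- y) q l * (1# - (- y) * p))
      ≈⟨ solve 4 (λ A B y p → A :* (𝟙 :- y :* p) :* (B :* (𝟙 :- (:- y) :* p)) := A :* B :* (𝟙 :- y :* y :* (p :* p))) refl _ _ y p ⟩
    poch y q l * poch (- y) q l * (1# - y * y * (p * p))
      ≈⟨ *-cong (poch-*-poch-neg y l) (+-congˡ (-‿cong (*-congˡ (sym (^ₙ-distrib-* q q l))))) ⟩
    poch (y * y) (q * q) (suc l)  ∎
    where
    p = q ^ₙ l

  -- Each factor takes up one `-q^l`: `-q^l (1 - q^{j-l}) = q^j - q^l`.
  differences-poch : ∀ l i →
    ((- 1#) ^ₙ i) * h (+ 2 ℤ.* + l ℤ.* + i) * poch (h (ℤ.- (+ 2 ℤ.* + l))) q i ≈ differences l i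
  differences-poch l i = trans (*-congʳ (*-congˡ (sym (h-^ₙ (+ 2 ℤ.* + l) i)))) (go i)
    where
    g = h (+ 2 ℤ.* + l)
    g⁻ = h (ℤ.- (+ 2 ℤ.* + l))
    gg⁻≈1 : g * g⁻ ≈ 1#
    gg⁻≈1 = sym (h-split (+ 2 ℤ.* + l) _ (≡.sym (ℤₚ.+-inverseʳ (+ 2 ℤ.* + l))))
    go : ∀ i → ((- 1#) ^ₙ i) * g ^ₙ i * poch g⁻ q i ≈ differences l i
    go zero = trans (*-identityʳ _) (*-identityˡ _)
    go (suc i) = begin
      ((- 1#) ^ₙ i) * - 1# * (g ^ₙ i * g) * (poch g⁻ q i * (1# - g⁻ * r))
        ≈⟨ solve 6 (λ m a g P g⁻ r → m :* (:- 𝟙) :* (a :* g) :* (P :* (𝟙 :- g⁻ :* r)) := m :* a :* P :* (g :* g⁻ :* r :- g))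
             refl ((- 1#) ^ₙ i) (g ^ₙ i) g _ g⁻ r ⟩
      ((- 1#) ^ₙ i) * g ^ₙ i * poch g⁻ q i * (g * g⁻ * r - g)
        ≈⟨ *-cong (go i) (+-cong (trans (*-congʳ gg⁻≈1) (*-identityˡ r)) (-‿cong (sym (h-^ₙ (+ 2) l)))) ⟩
      differences l i * (r - q ^ₙ l)  ∎
      where
      r = q ^ₙ i

  -- Assembly under the admissibility hypotheses.

  module _ (l n : ℕ) (x : Carrier) (admissible : Identity.Admissible s x l n) where
    open Identity s x l n using (lhs; rhs; summand)
    open Identity.Admissible admissible

    -- `M` consists of what `C-hypergeometric` and `powerSums-poch` leave on the left. On the right
    -- the same factors are denominators: `pochs₃ n` of the brackets, `1 - q^{1/2}` of the fraction,
    -- `N₁` of the prefactor.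
    x⁻ a N₁ M : Carrier
    x⁻ = x ⁻¹
    a = x * x * h (ℤ.- (+ 2))
    N₁ = poch (- 1#) q l
    M = pochs₃ n * (1# - h (+ 1)) * N₁

    xx⁻≈1 : x * x⁻ ≈ 1#
    xx⁻≈1 = inverse x x≢0

    aq≈xx : a * q ≈ x * x
    aq≈xx = trans (*-assoc _ _ _) (trans (*-congˡ (sym (h-+ (ℤ.- (+ 2)) (+ 2)))) (*-identityʳ _))

    aqp≈xxh : a * q * q ^ₙ l ≈ x * x * h (+ 2 ℤ.* + l)
    aqp≈xxh = *-cong aq≈xx (h-^ₙ (+ 2) l)

    -- Three separate denominators of the theorem form the single factorial in `denominator`. This
    -- also makes that factorial nonzero.
    poch-a : ∀ i → poch a q (suc (l ℕ.+ i)) ≈ (1# - a) * (poch (x * x) q l * poch (x * x * h (+ 2 ℤ.* + l)) q i)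
    poch-a i = trans (poch-head a q (l ℕ.+ i)) (*-congˡ (trans (poch-+ (a * q) q l i)
      (*-cong (poch-congˡ aq≈xx l) (poch-congˡ aqp≈xxh i))))

    poch-q-≉0 : poch q q l ≉0
    poch-q-≉0 = *-≉0ˡ d-br

    poch-a-≉0 : poch a q (suc (l ℕ.+ l)) ≉0
    poch-a-≉0 = ≉0-resp (sym (poch-a l)) (*-≉0 (*-≉0ˡ d-frac) (*-≉0 (*-≉0ˡ d-pre) (*-≉0ˡ (*-≉0ʳ d-br))))

    M≉0 : M ≉0
    M≉0 = *-≉0 (*-≉0 (≉0-resp (*-congˡ (*-identityʳ _)) d-cube) (*-≉0ʳ d-frac)) (*-≉0ˡ (*-≉0ʳ d-pre))

    weight : ℕ → Carrier
    weight k = C n k * q^k²+k k * (1# - h (+ 1) * q ^ₙ k)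

    lhsTerm : ℕ → Carrier
    lhsTerm k =
      poch (h (ℤ.- (+ 6 ℤ.* + n))) q³ k
      * bracket (x ∷ h (+ 2 ℤ.- + 2 ℤ.* + l) * x ⁻¹ ∷ [])
                (q ∷ - h (+ 2 ℤ.- + 2 ℤ.* + l) ∷ h (+ 1) ∷ - h (+ 3)
                   ∷ h (ℤ.- (+ 2) ℤ.- + 6 ℤ.* + n) ∷ [])
                q k
      * h (+ 2 ℤ.* + k)

    lhsTerm-Φ : ∀ k → k ℕ.≤ n → lhsTerm k * M ≈ weight k * Φ l x x⁻ k
    lhsTerm-Φ k k≤n = *-cancelʳ-≉0 d≉0 (begin
      P * (num * d ⁻¹) * h (+ 2 ℤ.* + k) * (pochs₃ n * (1# - h (+ 1)) * N₁) * d
        ≈⟨ solve 8 (λ P num d⁻ u D b N d → P :* (num :* d⁻) :* u :* (D :* b :* N) :* d := P :* (D :* b) :* u :* N :* (num :* d⁻ :* d))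
             refl P num (d ⁻¹) _ (pochs₃ n) (1# - h (+ 1)) N₁ d ⟩
      P * (pochs₃ n * (1# - h (+ 1))) * h (+ 2 ℤ.* + k) * N₁ * (num * d ⁻¹ * d)
        ≈⟨ *-cong (*-congʳ (trans (*-congˡ (sym (h-^ₙ (+ 2) k))) (C-hypergeometric n k))) (⁻¹-*-cancel d≉0) ⟩
      weight k * (a₁ * m * a₃ * a₄ * a₅) * N₁ * num
        ≈⟨ solve 8 (λ w a₁ m a₃ a₄ a₅ N num → w :* (a₁ :* m :* a₃ :* a₄ :* a₅) :* N :* num := w :* num :* (a₁ :* (m :* N :* (a₃ :* (a₄ :* a₅)))))
             refl (weight k) a₁ m a₃ a₄ a₅ N₁ num ⟩
      weight k * num * (a₁ * (m * N₁ * (a₃ * (a₄ * a₅))))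
        -- `m` may be 0 and is never cancelled: together with `N₁` it is traded for `a₂ * S`, and
        -- `a₂` is the factor still missing from `d`.
        ≈⟨ *-congˡ (*-congˡ (*-congʳ (powerSums-poch l k))) ⟩
      weight k * num * (a₁ * (a₂ * S * (a₃ * (a₄ * a₅))))
        ≈⟨ solve 9 (λ w X Y S a₁ a₂ a₃ a₄ a₅ → w :* (X :* (Y :* 𝟙)) :* (a₁ :* (a₂ :* S :* (a₃ :* (a₄ :* a₅))))
             := w :* (X :* Y :* S) :* (a₁ :* (a₂ :* (a₃ :* (a₄ :* (a₅ :* 𝟙))))))
             refl (weight k) _ _ S a₁ a₂ a₃ a₄ a₅ ⟩
      weight k * Φ l x x⁻ k * d  ∎)
      where
      P = poch (h (ℤ.- (+ 6 ℤ.* + n))) q³ k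
      num = prodPoch (x ∷ h (+ 2 ℤ.- + 2 ℤ.* + l) * x ⁻¹ ∷ []) q k
      d = prodPoch (q ∷ - h (+ 2 ℤ.- + 2 ℤ.* + l) ∷ h (+ 1) ∷ - h (+ 3) ∷ h (ℤ.- (+ 2) ℤ.- + 6 ℤ.* + n) ∷ []) q k
      d≉0 : d ≉0
      d≉0 = prodPoch-≉0-≤ (q ∷ - h (+ 2 ℤ.- + 2 ℤ.* + l) ∷ h (+ 1) ∷ - h (+ 3) ∷ h (ℤ.- (+ 2) ℤ.- + 6 ℤ.* + n) ∷ []) k≤n d-lhs
      a₁ = poch q q k
      a₂ = poch (- h (+ 2 ℤ.- + 2 ℤ.* + l)) q k
      a₃ = poch (h (+ 1)) q k
      a₄ = poch (- h (+ 3)) q k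
      a₅ = poch (h (ℤ.- (+ 2) ℤ.- + 6 ℤ.* + n)) q k
      m = poch (- q) q k
      S = powerSums l k

    prefactor : Carrier
    prefactor = bracket (x ∷ - x ∷ []) (x * x ∷ - 1# ∷ []) q l

    coefficient : ℕ → Carrier
    coefficient i =
      ((- 1#) ^ₙ i) * h (+ 2 ℤ.* + l ℤ.* + i)
      * ((1# - x * x * h (+ 4 ℤ.* + i ℤ.- + 2)) * ((1# - a) * (1# - h (+ 1))) ⁻¹)
      * bracket (h (ℤ.- (+ 2 ℤ.* + l)) ∷ a ∷ []) (q ∷ x * x * h (+ 2 ℤ.* + l) ∷ []) q i

    coefficient-G : ∀ i → i ℕ.≤ l → prefactor * coefficient i * ((1# - h (+ 1)) * N₁) ≈ G l i a
    coefficient-G i i≤l = *-cancelʳ-≉0 den≉0 (begin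
      prefactor * (ε * H * (e * f ⁻¹) * (num * d ⁻¹)) * (b * N₁) * denominator l i a
        ≈⟨ *-congˡ (*-congʳ (poch-a i)) ⟩
      prefactor * (ε * H * (e * f ⁻¹) * (num * d ⁻¹)) * (b * N₁) * ((1# - a) * (X * Y) * R)
        -- The factors of `denominator l i a`, with `1 - q^{1/2}` and `N₁`, are dealt out so that
        -- each of the three inverses meets its own denominator.
        ≈⟨ solve 13 (λ B ε H e f⁻ num d⁻ b N c X Y R →
             B :* (ε :* H :* (e :* f⁻) :* (num :* d⁻)) :* (b :* N) :* (c :* (X :* Y) :* R)
             := (B :* (X :* (N :* 𝟙))) :* (ε :* H) :* (e :* f⁻ :* (c :* b)) :* (num :* d⁻ :* (R :* (Y :* 𝟙))))
             refl prefactor ε H e (f ⁻¹) num (d ⁻¹) b N₁ (1# - a) X Y R ⟩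
      prefactor * (X * (N₁ * 1#)) * (ε * H) * (e * f ⁻¹ * f) * (num * d ⁻¹ * d)
        ≈⟨ *-cong (*-cong (*-congʳ (⁻¹-*-cancel d-pre)) (⁻¹-*-cancel d-frac)) (⁻¹-*-cancel d≉0) ⟩
      poch x q l * (poch (- x) q l * 1#) * (ε * H) * e * (poch g⁻ q i * (poch a q i * 1#))
        ≈⟨ solve 7 (λ x x′ ε H e g A → x :* (x′ :* 𝟙) :* (ε :* H) :* e :* (g :* (A :* 𝟙)) := x :* x′ :* (ε :* H :* g) :* e :* A)
             refl _ _ ε H e _ _ ⟩
      poch x q l * poch (- x) q l * (ε * H * poch g⁻ q i) * e * poch a q i
        ≈⟨ *-congʳ (*-cong (*-cong (trans (poch-*-poch-neg x l) (poch-congˡ (sym aq≈xx) l)) (differences-poch l i)) e≈) ⟩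
      numerator l i a
        ≈⟨ ⁻¹-*-cancel den≉0 ⟨
      G l i a * denominator l i a  ∎)
      where
      ε = (- 1#) ^ₙ i
      H = h (+ 2 ℤ.* + l ℤ.* + i)
      e = 1# - x * x * h (+ 4 ℤ.* + i ℤ.- + 2)
      b = 1# - h (+ 1)
      f = (1# - a) * b
      g⁻ = h (ℤ.- (+ 2 ℤ.* + l))
      num = prodPoch (g⁻ ∷ a ∷ []) q i
      d = prodPoch (q ∷ x * x * h (+ 2 ℤ.* + l) ∷ []) q i
      X = poch (x * x) q l
      Y = poch (x * x * h (+ 2 ℤ.* + l)) q i
      R = poch q q i
      den≉0 : denominator l i a ≉0
      den≉0 = *-≉0 (poch-≉0-≤ (ℕ.s≤s (ℕₚ.+-monoʳ-≤ l i≤l)) poch-a-≉0) (poch-≉0-≤ i≤l poch-q-≉0)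
      d≉0 : d ≉0
      d≉0 = prodPoch-≉0-≤ (q ∷ x * x * h (+ 2 ℤ.* + l) ∷ []) i≤l d-br
      e≈ : e ≈ 1# - a * (q ^ₙ i * q ^ₙ i)
      e≈ = +-congˡ (-‿cong (begin
        x * x * h (+ 4 ℤ.* + i ℤ.- + 2)
          ≈⟨ *-congˡ (trans (h-split (ℤ.- (+ 2)) (+ 2 ℤ.* + i ℤ.+ + 2 ℤ.* + i) (step (+ i))) (*-congˡ (h-+ (+ 2 ℤ.* + i) _))) ⟩
        x * x * (h (ℤ.- (+ 2)) * (h (+ 2 ℤ.* + i) * h (+ 2 ℤ.* + i)))
          ≈⟨ *-assoc _ _ _ ⟨
        a * (h (+ 2 ℤ.* + i) * h (+ 2 ℤ.* + i))
          ≈⟨ *-congˡ (*-cong (h-^ₙ (+ 2) i) (h-^ₙ (+ 2) i)) ⟨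
        a * (q ^ₙ i * q ^ₙ i)  ∎))
        where
        step : ∀ j → + 4 ℤ.* j ℤ.- + 2 ≡ ℤ.- (+ 2) ℤ.+ (+ 2 ℤ.* j ℤ.+ + 2 ℤ.* j)
        step = solve-∀

    bracketA bracketB brace : ℕ → Carrier
    bracketA i = bracket (h (+ 6 ℤ.+ + 2 ℤ.* + i) * x ∷ h (+ 6 ℤ.- + 2 ℤ.* + i) * x ⁻¹ ∷ [])
                         (h (+ 4) ∷ h (+ 8) ∷ []) (h (+ 6)) n
    bracketB i = bracket (h (+ 4 ℤ.+ + 2 ℤ.* + i) * x ∷ h (+ 8 ℤ.- + 2 ℤ.* + i) * x ⁻¹ ∷ [])
                         (h (+ 4) ∷ h (+ 8) ∷ []) (h (+ 6)) n
    brace i = (1# - x * h (+ 2 ℤ.* + i)) * (1# + x * h (+ 2 ℤ.* + i ℤ.- + 1)) ⁻¹ * bracketA i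
      - h (+ 1) * (1# - x * h (+ 2 ℤ.* + i ℤ.- + 2)) * (1# + x * h (+ 2 ℤ.* + i ℤ.- + 1)) ⁻¹ * bracketB i

    -- The two brackets are cubic expansions at `y = xq^i` and at `y/q`. `half-power-split` merges
    -- them term by term, and its factor `1 + q^(-1/2)y` is the denominator `η`.
    brace-expansion : ∀ i → i ℕ.≤ l → brace i * pochs₃ n ≈ sumTo n (λ k → weight k * basis x x⁻ k i)
    brace-expansion i i≤l = *-cancelʳ-≉0 (d-half i i≤l) (begin
      (α * η ⁻¹ * bracketA i - β * η ⁻¹ * bracketB i) * pochs₃ n * η
        ≈⟨ solve 8 (λ α η⁻ A β B D D′ η → (α :* η⁻ :* A :- β :* η⁻ :* B) :* (D :* D′) :* η
             := (α :* η⁻ :* η) :* (A :* (D :* (D′ :* 𝟙))) :- (β :* η⁻ :* η) :* (B :* (D :* (D′ :* 𝟙))))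
             refl α (η ⁻¹) (bracketA i) β (bracketB i) _ _ η ⟩
      α * η ⁻¹ * η * (bracketA i * d) - β * η ⁻¹ * η * (bracketB i * d)
        ≈⟨ +-cong (*-cong (⁻¹-*-cancel η≉0) (trans (⁻¹-*-cancel d-cube) (*-congˡ (*-identityʳ _))))
             (-‿cong (*-cong (⁻¹-*-cancel η≉0) (trans (⁻¹-*-cancel d-cube) (*-congˡ (*-identityʳ _))))) ⟩
      α * (poch (h (+ 6 ℤ.+ + 2 ℤ.* + i) * x) q³ n * poch (h (+ 6 ℤ.- + 2 ℤ.* + i) * x⁻) q³ n)
        - β * (poch (h (+ 4 ℤ.+ + 2 ℤ.* + i) * x) q³ n * poch (h (+ 8 ℤ.- + 2 ℤ.* + i) * x⁻) q³ n)
        ≈⟨ +-cong (*-congˡ (*-cong (poch-congˡ A₁ n) (poch-congˡ A₂ n)))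
             (-‿cong (*-cong (*-congˡ (+-congˡ (-‿cong xh≈))) (*-cong (poch-congˡ B₁ n) (poch-congˡ B₂ n)))) ⟩
      (1# - y) * (poch (y * q³) q³ n * poch (y⁻ * q³) q³ n)
        - h (+ 1) * (1# - y′) * (poch (y′ * q³) q³ n * poch (y⁻ * q * q³) q³ n)
        ≈⟨ +-cong (*-congˡ (cubic-expansion yy⁻≈1 n)) (-‿cong (*-congˡ (cubic-expansion y′y⁻q≈1 n))) ⟨
      (1# - y) * sumTo n (λ k → C n k * expansionBasis y y⁻ k)
        - h (+ 1) * (1# - y′) * sumTo n (λ k → C n k * expansionBasis y′ (y⁻ * q) k)
        ≈⟨ +-cong (sumTo-*ˡ n _ _) (trans (solve 2 (λ a b → :- (a :* b) := (:- a) :* b) refl _ _) (sumTo-*ˡ n _ _)) ⟩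
      sumTo n (λ k → (1# - y) * (C n k * expansionBasis y y⁻ k))
        + sumTo n (λ k → - (h (+ 1) * (1# - y′)) * (C n k * expansionBasis y′ (y⁻ * q) k))
        ≈⟨ sumTo-+ n _ _ ⟨
      sumTo n (λ k → (1# - y) * (C n k * expansionBasis y y⁻ k)
        + - (h (+ 1) * (1# - y′)) * (C n k * expansionBasis y′ (y⁻ * q) k))
        ≈⟨ sumTo-cong n (λ k _ → term k) ⟩
      sumTo n (λ k → weight k * basis x x⁻ k i * η)
        ≈⟨ sumTo-*ʳ n η _ ⟨
      sumTo n (λ k → weight k * basis x x⁻ k i) * η  ∎)
      where
      η = 1# + x * h (+ 2 ℤ.* + i ℤ.- + 1)
      η≉0 = d-half i i≤l
      α = 1# - x * h (+ 2 ℤ.* + i)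
      β = h (+ 1) * (1# - x * h (+ 2 ℤ.* + i ℤ.- + 2))
      d = prodPoch (h (+ 4) ∷ h (+ 8) ∷ []) (h (+ 6)) n
      y = x * h (+ 2 ℤ.* + i)
      y⁻ = h (ℤ.- (+ 2 ℤ.* + i)) * x⁻
      y′ = y * h (ℤ.- (+ 2))
      yy⁻≈1 : y * y⁻ ≈ 1#
      yy⁻≈1 = trans (solve 4 (λ x g g⁻ x⁻ → x :* g :* (g⁻ :* x⁻) := x :* x⁻ :* (g :* g⁻)) refl x _ _ x⁻)
        (trans (*-cong xx⁻≈1 (sym (h-split (+ 2 ℤ.* + i) _ (≡.sym (ℤₚ.+-inverseʳ (+ 2 ℤ.* + i)))))) (*-identityˡ 1#))
      y′y⁻q≈1 : y′ * (y⁻ * q) ≈ 1#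
      y′y⁻q≈1 = trans (solve 4 (λ y g y⁻ q → y :* g :* (y⁻ :* q) := y :* y⁻ :* (g :* q)) refl y _ y⁻ q)
        (trans (*-cong yy⁻≈1 (sym (h-+ (ℤ.- (+ 2)) (+ 2)))) (*-identityˡ 1#))
      xh≈ : x * h (+ 2 ℤ.* + i ℤ.- + 2) ≈ y′
      xh≈ = trans (*-congˡ (h-+ (+ 2 ℤ.* + i) _)) (sym (*-assoc _ _ _))
      η≈ : η ≈ 1# + y * h (ℤ.- (+ 1))
      η≈ = +-congˡ (trans (*-congˡ (h-+ (+ 2 ℤ.* + i) _)) (sym (*-assoc _ _ _)))
      A₁ : h (+ 6 ℤ.+ + 2 ℤ.* + i) * x ≈ y * q³
      A₁ = trans (*-congʳ (h-+ (+ 6) (+ 2 ℤ.* + i))) (solve 3 (λ a b x → a :* b :* x := x :* b :* a) refl _ _ x)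
      A₂ : h (+ 6 ℤ.- + 2 ℤ.* + i) * x⁻ ≈ y⁻ * q³
      A₂ = trans (*-congʳ (h-+ (+ 6) (ℤ.- (+ 2 ℤ.* + i)))) (solve 3 (λ a b x → a :* b :* x := b :* x :* a) refl _ _ x⁻)
      B₁ : h (+ 4 ℤ.+ + 2 ℤ.* + i) * x ≈ y′ * q³
      B₁ = begin
        h (+ 4 ℤ.+ + 2 ℤ.* + i) * x                 ≈⟨ *-congʳ (h-+ (+ 4) (+ 2 ℤ.* + i)) ⟩
        h (+ 4) * h (+ 2 ℤ.* + i) * x               ≈⟨ *-congʳ (*-congʳ (h-+ (ℤ.- (+ 2)) (+ 6))) ⟩
        h (ℤ.- (+ 2)) * q³ * h (+ 2 ℤ.* + i) * x
          ≈⟨ solve 4 (λ a b c x → a :* b :* c :* x := x :* c :* a :* b) refl _ _ _ x ⟩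
        y′ * q³                                     ∎
      B₂ : h (+ 8 ℤ.- + 2 ℤ.* + i) * x⁻ ≈ y⁻ * q * q³
      B₂ = begin
        h (+ 8 ℤ.- + 2 ℤ.* + i) * x⁻                 ≈⟨ *-congʳ (h-+ (+ 8) (ℤ.- (+ 2 ℤ.* + i))) ⟩
        h (+ 8) * h (ℤ.- (+ 2 ℤ.* + i)) * x⁻         ≈⟨ *-congʳ (*-congʳ (h-+ (+ 2) (+ 6))) ⟩
        q * q³ * h (ℤ.- (+ 2 ℤ.* + i)) * x⁻
          ≈⟨ solve 4 (λ a b c x → a :* b :* c :* x := c :* x :* a :* b) refl _ _ _ x⁻ ⟩
        y⁻ * q * q³                                  ∎
      y′q≈y : y′ * q ≈ y
      y′q≈y = trans (*-assoc _ _ _) (trans (*-congˡ (sym (h-+ (ℤ.- (+ 2)) (+ 2)))) (*-identityʳ y))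
      basis≈ : ∀ k → poch y q k * poch (y⁻ * q) q k ≈ basis x x⁻ k i
      basis≈ k = *-cong (poch-congˡ (*-congˡ (sym (h-^ₙ (+ 2) i))) k) (poch-congˡ (sym (trans
        (*-congʳ (h-+ (+ 2) (ℤ.- (+ 2 ℤ.* + i)))) (solve 3 (λ a b x → a :* b :* x := b :* x :* a) refl _ _ x⁻))) k)
      term : ∀ k → (1# - y) * (C n k * expansionBasis y y⁻ k)
          + - (h (+ 1) * (1# - y′)) * (C n k * expansionBasis y′ (y⁻ * q) k)
        ≈ weight k * basis x x⁻ k i * η
      term k = begin
        (1# - y) * (C n k * (E * (poch (y * q) q k * Z)))
          + - (h (+ 1) * (1# - y′)) * (C n k * (E * (poch (y′ * q) q k * poch (y⁻ * q * q) q k)))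
          ≈⟨ solve 6 (λ a c e p b p′ → a :* (c :* (e :* p)) :+ (:- b) :* (c :* (e :* p′)) := c :* e :* (a :* p :- b :* p′))
               refl (1# - y) (C n k) E _ (h (+ 1) * (1# - y′)) _ ⟩
        C n k * E * ((1# - y) * (poch (y * q) q k * Z)
          - h (+ 1) * (1# - y′) * (poch (y′ * q) q k * poch (y⁻ * q * q) q k))
          ≈⟨ *-congˡ (+-congˡ (-‿cong (*-congˡ (*-congʳ (poch-congˡ y′q≈y k))))) ⟩
        C n k * E * ((1# - y) * (poch (y * q) q k * Z)
          - h (+ 1) * (1# - y′) * (poch y q k * poch (y⁻ * q * q) q k))
          ≈⟨ *-congˡ (half-power-split yy⁻≈1 k) ⟨
        C n k * E * ((1# - h (+ 1) * q ^ₙ k) * (poch y q k * Z) * (1# + y * h (ℤ.- (+ 1))))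
          ≈⟨ *-congˡ (*-cong (*-congˡ (basis≈ k)) (sym η≈)) ⟩
        C n k * E * ((1# - h (+ 1) * q ^ₙ k) * basis x x⁻ k i * η)
          ≈⟨ solve 4 (λ a b c d → a :* (b :* c :* d) := a :* b :* c :* d) refl (C n k * E) _ _ η ⟩
        weight k * basis x x⁻ k i * η  ∎
        where
        E = q^k²+k k
        Z = poch (y⁻ * q) q k

    transformation : lhs ≈ rhs
    transformation = *-cancelʳ-≉0 M≉0 (begin
      lhs * M
        ≈⟨ sumTo-*ʳ n M _ ⟩
      sumTo n (λ k → lhsTerm k * M)
        ≈⟨ sumTo-cong n (λ k k≤n → trans (lhsTerm-Φ k k≤n)
             (trans (*-congˡ (connection l xx⁻≈1 aq≈xx poch-a-≉0 poch-q-≉0 k)) (sumTo-*ˡ l _ _))) ⟩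
      sumTo n (λ k → sumTo l (λ i → weight k * (G l i a * basis x x⁻ k i)))
        ≈⟨ sumTo-swap n l _ ⟩
      sumTo l (λ i → sumTo n (λ k → weight k * (G l i a * basis x x⁻ k i)))
        ≈⟨ sumTo-cong l (λ i i≤l → trans
             (sumTo-cong n λ k _ → solve 3 (λ a b c → a :* (b :* c) := b :* (a :* c)) refl (weight k) (G l i a) _)
             (trans (sym (sumTo-*ˡ n _ _)) (*-cong (sym (coefficient-G i i≤l)) (sym (brace-expansion i i≤l))))) ⟩
      sumTo l (λ i → prefactor * coefficient i * ((1# - h (+ 1)) * N₁) * (brace i * pochs₃ n))
        -- `coefficient i * brace i` is `summand i` by definition, so only a reordering of factors
        -- is needed.
        ≈⟨ sumTo-cong l (λ i _ → solve 6 (λ B c b N f D → B :* c :* (b :* N) :* (f :* D) := B :* (c :* f) :* (D :* b :* N))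
             refl prefactor (coefficient i) (1# - h (+ 1)) N₁ (brace i) (pochs₃ n)) ⟩
      sumTo l (λ i → prefactor * summand i * M)
        ≈⟨ trans (*-congʳ (sumTo-*ˡ l _ _)) (sumTo-*ʳ l M _) ⟨
      rhs * M  ∎)

theorem15 : ∀ {c ℓ : Level} (F : ComplexField c ℓ) → let open ComplexField F in let open Notation F in
    ∀ (s : Carrier) (ℓ' n : ℕ) (x : Carrier) →
    Identity.Admissible s x ℓ' n → Identity.lhs s x ℓ' n ≈ Identity.rhs s x ℓ' n
theorem15 F s ℓ' n x admissible = Transformation.transformation F s (s≢0 admissible) ℓ' n x admissible
  where open Notation.Identity.Admissible
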